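{- Let $G$ be a connected graph of order $n\geq 3$ with $|E(G)|\geq\binom{n-2}{2}+2$. Then $prc(G)=\chi'(G)$, or $G$ is isomorphic to one of $P_4$, $Z_2$, $G_{6.3}$.
   Context: A path in an edge-coloured graph is a rainbow path if its edges receive pairwise distinct colours. The proper rainbow connection number $prc(G)$ of a connected graph is the minimum number of colours in a proper edge-colouring (adjacent edges get distinct colours) such that every two distinct vertices are joined by a rainbow path; $\chi'(G)$ is the chromatic index. $P_4$ is the path on 4 vertices. $Z_2$ is the graph on vertices $a,b,c,d,e$ with edges $ab,bc,ca,ad,de$ (a triangle with a pendant path of length 2 attached at one triangle vertex). $G_{6.3}$ is the graph on vertices $w,w_1,w_2,w_3,u_1,u_2$ with the 8 edges $ww_1, ww_2, ww_3, w_2w_3, w_2u_2, u_1u_2, w_1u_1, w_1u_2$. -}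

module Defs where

open import Data.Fin using (Fin)
open import Data.Fin.Patterns using (0F; 1F; 2F; 3F; 4F; 5F)
open import Data.Fin.Properties using (_≟_; _<?_)
open import Data.List using (List; []; _∷_; allFin; cartesianProduct; filter; length)
import Data.List.Membership.DecPropositional as DecMembership
open import Data.List.Membership.Propositional using (_∈_)
open import Data.List.Relation.Unary.Unique.Propositional using (Unique)
open import Data.Nat using (ℕ; _≤_)
open import Data.Product using (Σ-syntax; _×_; _,_)
open import Data.Product.Properties using (≡-dec)
open import Data.Sum using (_⊎_; swap)
open import Function using (_↔_; _⇔_; Inverse)
open import Level using (0ℓ)
open import Relation.Binary using (Rel; Decidable; Irreflexive; Symmetric)
open import Relation.Binary.Construct.Closure.ReflexiveTransitive using (Star; ε; _◅_)
open import Relation.Binary.PropositionalEquality using (_≡_; _≢_; ≢-sym)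
open import Relation.Nullary.Decidable using (_×-dec_; _⊎-dec_; ¬?)

record Graph (n : ℕ) : Set₁ where
  infix 4 _~_ _~?_
  field
    _~_      : Rel (Fin n) 0ℓ
    _~?_     : Decidable _~_
    ~-sym    : Symmetric _~_
    ~-irrefl : Irreflexive _≡_ _~_

  -- Each edge is listed once, with its smaller endpoint first.
  edges : List (Fin n × Fin n)
  edges = filter (λ (u , v) → (u <? v) ×-dec (u ~? v))
                 (cartesianProduct (allFin n) (allFin n))

  size : ℕ
  size = length edges

  Walk : Rel (Fin n) 0ℓ
  Walk = Star _~_

  vertices : ∀ {u v} → Walk u v → List (Fin n)
  vertices {u} ε       = u ∷ []
  vertices {u} (_ ◅ p) = u ∷ vertices p

  IsPath : ∀ {u v} → Walk u v → Set
  IsPath p = Unique (vertices p)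

  Connected : Set
  Connected = ∀ u v → Σ[ p ∈ Walk u v ] IsPath p

open Graph public using (size; Connected)

-- Colourings of the (unoriented) edges. `colour-sym`, being stated for
-- arbitrary e and e′, also makes the colour independent of the adjacency proof.
record EdgeColouring {n : ℕ} (G : Graph n) (k : ℕ) : Set where
  open Graph G
  field
    colour     : ∀ {u v} → u ~ v → Fin k
    colour-sym : ∀ {u v} (e : u ~ v) (e′ : v ~ u) → colour e ≡ colour e′

  -- By colour-sym, it suffices to compare adjacent edges by their common tail.
  Proper : Set
  Proper = ∀ {u v w} (e : u ~ v) (f : u ~ w) → v ≢ w → colour e ≢ colour f

  colours : ∀ {u v} → Walk u v → List (Fin k)
  colours ε       = []
  colours (e ◅ p) = colour e ∷ colours p

  IsRainbowPath : ∀ {u v} → Walk u v → Set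
  IsRainbowPath p = IsPath p × Unique (colours p)

  RainbowConnected : Set
  RainbowConnected = ∀ u v → u ≢ v → Σ[ p ∈ Walk u v ] IsRainbowPath p

open EdgeColouring public using (Proper; RainbowConnected)

IsMinimum : (ℕ → Set) → ℕ → Set
IsMinimum P k = P k × (∀ j → P j → k ≤ j)

-- The invariants χ′ and prc are given by their graphs: `IsChromaticIndex G k`
-- is χ′(G) = k and `IsProperRainbowConnectionNumber G k` is prc(G) = k.
-- A colouring with palette Fin k may leave colours unused, which does not
-- affect the minimum.
IsChromaticIndex : ∀ {n} → Graph n → ℕ → Set
IsChromaticIndex G = IsMinimum λ k → Σ[ c ∈ EdgeColouring G k ] Proper c

IsProperRainbowConnectionNumber : ∀ {n} → Graph n → ℕ → Set
IsProperRainbowConnectionNumber G =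
  IsMinimum λ k → Σ[ c ∈ EdgeColouring G k ] (Proper c × RainbowConnected c)

infix 4 _≅_
_≅_ : ∀ {m n} → Graph m → Graph n → Set
_≅_ {m} {n} G H =
  Σ[ φ ∈ Fin m ↔ Fin n ] (∀ u v → u G.~ v ⇔ Inverse.to φ u H.~ Inverse.to φ v)
  where
  module G = Graph G
  module H = Graph H

-- The graph with the given unordered pairs as edges; repetitions and loops in
-- the list are ignored.
fromEdges : ∀ {n} → List (Fin n × Fin n) → Graph n
fromEdges {n} es = record
  { _~_      = λ u v → u ≢ v × ((u , v) ∈ es ⊎ (v , u) ∈ es)
  ; _~?_     = λ u v → ¬? (u ≟ v) ×-dec (((u , v) ∈? es) ⊎-dec ((v , u) ∈? es))
  ; ~-sym    = λ (u≢v , e) → ≢-sym u≢v , swap e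
  ; ~-irrefl = λ u≡v (u≢v , _) → u≢v u≡v
  }
  where open DecMembership (≡-dec (_≟_ {n}) (_≟_ {n})) using (_∈?_)

P₄ : Graph 4
P₄ = fromEdges ((0F , 1F) ∷ (1F , 2F) ∷ (2F , 3F) ∷ [])

Z₂ : Graph 5
Z₂ = fromEdges ((a , b) ∷ (b , c) ∷ (c , a) ∷ (a , d) ∷ (d , e) ∷ [])
  where
  a b c d e : Fin 5
  a = 0F
  b = 1F
  c = 2F
  d = 3F
  e = 4F

G₆₋₃ : Graph 6
G₆₋₃ = fromEdges ((w , w₁) ∷ (w , w₂) ∷ (w , w₃) ∷ (w₂ , w₃)
                ∷ (w₂ , u₂) ∷ (u₁ , u₂) ∷ (w₁ , u₁) ∷ (w₁ , u₂) ∷ [])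
  where
  w w₁ w₂ w₃ u₁ u₂ : Fin 6
  w  = 0F
  w₁ = 1F
  w₂ = 2F
  w₃ = 3F
  u₁ = 4F
  u₂ = 5F

{-# OPTIONS --safe #-}

-- Fix a proper edge-colouring with χ′(G) colours. If u and v are not joined by a
-- rainbow path of length at most 3, then they are non-adjacent without common
-- neighbours, and the edges between N(u) and N(v) form a matching along which
-- the colours of ux and vy agree. Such a pair alone forces n - 1 non-adjacent
-- pairs and G has at most 2n - 5, which leaves only d(u) + d(v) - 2 of them among
-- the other vertices, while the matching already forces d(u)(d(v) - 1) and
-- d(v)(d(u) - 1) of them. Hence one of u, v is pendant or d(u) = d(v) = 2, with
-- the rest of the graph determined. In these configurations there is a rainbow
-- path of length 4, or G is one of the three exceptions, or G has another proper
-- rainbow colouring with no more colours.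
module Submission where

open import Defs
import Algebra.Properties.Semiring.Sum as SemiringSum
open import Data.Bool using (if_then_else_)
open import Data.Empty using (⊥-elim)
open import Data.Fin as Fin using (Fin; zero; suc; toℕ; inject≤; punchIn; punchOut; _↑ˡ_; finToFun; funToFin)
open import Data.Fin.Patterns using (0F; 1F; 2F; 3F; 4F; 5F)
open import Data.Fin.Properties as Fin using (_≟_; _<?_; any?; all?)
open import Data.List as List using (List; []; _∷_; _++_; length; filter; cartesianProduct)
import Data.List.Membership.DecPropositional as DecMembership
open import Data.List.Membership.Propositional using (_∈_)
import Data.List.Properties as List
open import Data.List.Relation.Binary.Permutation.Propositional using (_↭_; ↭-refl; ↭-sym; ↭-trans; prep; ↭⇒↭ₛ)
import Data.List.Relation.Binary.Permutation.Propositional.Properties as ↭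
import Data.List.Relation.Binary.Permutation.Setoid.Properties as ↭ₛ
open import Data.List.Relation.Unary.All as All using (All; []; _∷_)
open import Data.List.Relation.Unary.AllPairs using (AllPairs; []; _∷_)
open import Data.List.Relation.Unary.Unique.Propositional using (Unique)
open import Data.Nat using (ℕ; zero; suc; _+_; _*_; _∸_; _^_; _≤_; _<_; _≥_; z≤n; s≤s)
open import Data.Nat.Combinatorics using (_C_; nC1≡n; nCk+nC[k+1]≡[n+1]C[k+1])
open import Data.Nat.DivMod using (_%_; _mod_; m%n<n; m<n⇒m%n≡m; %-distribˡ-+; [m+n]%n≡m%n)
import Data.Nat.Properties as ℕ
open import Data.Nat.Tactic.RingSolver using (solve-∀)
open import Data.Product using (Σ-syntax; ∃-syntax; _×_; _,_; proj₁; proj₂)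
open import Data.Product.Properties using (≡-dec)
open import Data.Sum as Sum using (_⊎_; inj₁; inj₂)
open import Data.Vec using ([]; _∷_; lookup)
open import Data.Vec.Relation.Unary.All using ([]; _∷_)
open import Data.Vec.Relation.Unary.Unique.Propositional using ([]; _∷_) renaming (Unique to Uniqueᵥ)
open import Data.Vec.Relation.Unary.Unique.Propositional.Properties using (lookup-injective)
open import Function using (_∘_; case_of_; const; mk⇔; mk↔ₛ′)
open import Function.Definitions using (Injective)
open import Relation.Binary.Construct.Closure.ReflexiveTransitive as Star using (ε; _◅_; revApp)
open import Relation.Binary.Definitions using (tri<; tri≈; tri>)
open import Relation.Binary.PropositionalEquality
open import Relation.Nullary using (¬_; Dec; yes; no; does; contradiction)
open import Relation.Nullary.Decidable
  using (_×-dec_; _⊎-dec_; _→-dec_; ¬?; map′; decidable-stable; True; toWitness)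
open import Relation.Unary using (Pred) renaming (Decidable to Decidable₁)

open SemiringSum ℕ.+-*-semiring
  using (sum; sum-syntax; sum-cong-≗; sum-replicate-zero; ∑-distrib-+; ∑-comm; *-distribˡ-sum; *-distribʳ-sum)

-- No colouring is repaired pair by pair: each pair of vertices gives a rainbow path in the fixed
-- colouring or a verdict on the whole graph. Recolouring cannot be avoided, however. If `G` is a
-- complete graph with pendant edges ux and vy at x ≠ y, every path from u to v uses both edges, so
-- a colouring in which they agree cannot be rescued. The replacement colours ij by i + j modulo n -
-- 2, which gives the two edges 0 and 2; these coincide only for modulus 2, and that is how P₄
-- arises. Each exceptional graph is the smallest member of its configuration: one more vertex
-- provides a rainbow path of length 4 or room to recolour. Counts run over ordered pairs, so the
-- bounds on non-adjacent pairs appear doubled.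

-- Counting with sums of indicators

𝟙 : ∀ {p} {P : Set p} → Dec P → ℕ
𝟙 P? = if does P? then 1 else 0

module _ {p} {P : Set p} where

  𝟙-yes : (P? : Dec P) → P → 𝟙 P? ≡ 1
  𝟙-yes (yes _) _ = refl
  𝟙-yes (no ¬p) p = contradiction p ¬p

  𝟙-no : (P? : Dec P) → ¬ P → 𝟙 P? ≡ 0
  𝟙-no (yes p) ¬p = contradiction p ¬p
  𝟙-no (no _)  _  = refl

𝟙-cong : ∀ {p q} {P : Set p} {Q : Set q} (P? : Dec P) (Q? : Dec Q) → (P → Q) → (Q → P) → 𝟙 P? ≡ 𝟙 Q?
𝟙-cong (yes _) (yes _) _   _   = refl
𝟙-cong (yes p) (no ¬q) P⇒Q _   = contradiction (P⇒Q p) ¬q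
𝟙-cong (no ¬p) (yes q) _   Q⇒P = contradiction (Q⇒P q) ¬p
𝟙-cong (no _)  (no _)  _   _   = refl

sum-mono-≤ : ∀ {n} {f g : Fin n → ℕ} → (∀ i → f i ≤ g i) → sum f ≤ sum g
sum-mono-≤ {zero}  f≤g = z≤n
sum-mono-≤ {suc n} f≤g = ℕ.+-mono-≤ (f≤g zero) (sum-mono-≤ (f≤g ∘ suc))

sum-const : ∀ n x → ∑[ i < n ] x ≡ n * x
sum-const zero    x = refl
sum-const (suc n) x = cong (x +_) (sum-const n x)

sum-zero : ∀ {n} {f : Fin n → ℕ} → (∀ i → f i ≡ 0) → sum f ≡ 0
sum-zero {n} f≡0 = trans (sum-cong-≗ f≡0) (sum-replicate-zero n)

sum-𝟙-≟ : ∀ {n} (i : Fin n) → ∑[ j < n ] 𝟙 (i ≟ j) ≡ 1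
sum-𝟙-≟ {suc n} zero = cong suc (sum-zero {n} (λ j → 𝟙-no (zero ≟ suc j) λ ()))
sum-𝟙-≟ (suc i) = trans (sum-cong-≗ pred-≟) (sum-𝟙-≟ i)
  where
  pred-≟ : ∀ j → 𝟙 (suc i ≟ suc j) ≡ 𝟙 (i ≟ j)
  pred-≟ j with i ≟ j
  ... | yes _ = refl
  ... | no _  = refl

sum-𝟙-≤1 : ∀ {n p} {P : Pred (Fin n) p} (P? : Decidable₁ P) →
           (∀ {i j} → P i → P j → i ≡ j) → ∑[ i < n ] 𝟙 (P? i) ≤ 1
sum-𝟙-≤1 {n} P? unique with any? P?
... | yes (i , Pi) = subst (∑[ j < n ] 𝟙 (P? j) ≤_) (sum-𝟙-≟ i) (sum-mono-≤ bound)
  where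
  bound : ∀ j → 𝟙 (P? j) ≤ 𝟙 (i ≟ j)
  bound j with P? j
  ... | no _   = z≤n
  ... | yes Pj = ℕ.≤-reflexive (sym (𝟙-yes (i ≟ j) (unique Pi Pj)))
... | no ¬∃P = ℕ.≤-trans (ℕ.≤-reflexive (sum-zero λ j → 𝟙-no (P? j) (¬∃P ∘ (j ,_)))) z≤n

∑∑-distrib-+ : ∀ {m n} (f g : Fin m → Fin n → ℕ) →
  ∑[ i < m ] ∑[ j < n ] (f i j + g i j) ≡
  ∑[ i < m ] ∑[ j < n ] f i j + ∑[ i < m ] ∑[ j < n ] g i j
∑∑-distrib-+ f g =
  trans (sum-cong-≗ (λ i → ∑-distrib-+ (f i) (g i))) (∑-distrib-+ (sum ∘ f) (sum ∘ g))

∑∑-cong : ∀ {m n} {f g : Fin m → Fin n → ℕ} → (∀ i j → f i j ≡ g i j) →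
  ∑[ i < m ] ∑[ j < n ] f i j ≡ ∑[ i < m ] ∑[ j < n ] g i j
∑∑-cong f≡g = sum-cong-≗ (sum-cong-≗ ∘ f≡g)

∑∑-mono-≤ : ∀ {m n} {f g : Fin m → Fin n → ℕ} → (∀ i j → f i j ≤ g i j) →
  ∑[ i < m ] ∑[ j < n ] f i j ≤ ∑[ i < m ] ∑[ j < n ] g i j
∑∑-mono-≤ f≤g = sum-mono-≤ (sum-mono-≤ ∘ f≤g)

sum-𝟙-≟-* : ∀ {n} (i : Fin n) (f : Fin n → ℕ) → ∑[ j < n ] (𝟙 (i ≟ j) * f j) ≡ f i
sum-𝟙-≟-* {n} i f = begin
  ∑[ j < n ] (𝟙 (i ≟ j) * f j)   ≡⟨ sum-cong-≗ {n} at-i ⟩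
  ∑[ j < n ] (f i * 𝟙 (i ≟ j))   ≡⟨ *-distribˡ-sum {n} (f i) (λ j → 𝟙 (i ≟ j)) ⟨
  f i * ∑[ j < n ] 𝟙 (i ≟ j)     ≡⟨ cong (f i *_) (sum-𝟙-≟ i) ⟩
  f i * 1                        ≡⟨ ℕ.*-identityʳ (f i) ⟩
  f i                            ∎
  where
  open ≡-Reasoning
  at-i : ∀ j → 𝟙 (i ≟ j) * f j ≡ f i * 𝟙 (i ≟ j)
  at-i j with i ≟ j
  ... | yes refl = ℕ.*-comm 1 (f i)
  ... | no _     = sym (ℕ.*-zeroʳ (f i))

𝟙-× : ∀ {p q} {P : Set p} {Q : Set q} (P? : Dec P) (Q? : Dec Q) → 𝟙 (P? ×-dec Q?) ≡ 𝟙 P? * 𝟙 Q?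
𝟙-× (no _)  _       = refl
𝟙-× (yes _) (no _)  = refl
𝟙-× (yes _) (yes _) = refl

∑∑-row : ∀ {n} (i : Fin n) {q} {Q : Pred (Fin n) q} (Q? : Decidable₁ Q) →
  ∑[ k < n ] ∑[ j < n ] 𝟙 ((i ≟ k) ×-dec Q? j) ≡ ∑[ j < n ] 𝟙 (Q? j)
∑∑-row {n} i Q? = begin
  ∑[ k < n ] ∑[ j < n ] 𝟙 ((i ≟ k) ×-dec Q? j)    ≡⟨ ∑∑-cong (λ k j → 𝟙-× (i ≟ k) (Q? j)) ⟩
  ∑[ k < n ] ∑[ j < n ] (𝟙 (i ≟ k) * 𝟙 (Q? j))    ≡⟨ sum-cong-≗ {n} (λ k → *-distribˡ-sum {n} (𝟙 (i ≟ k)) (λ j → 𝟙 (Q? j))) ⟨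
  ∑[ k < n ] (𝟙 (i ≟ k) * ∑[ j < n ] 𝟙 (Q? j))    ≡⟨ sum-𝟙-≟-* i _ ⟩
  ∑[ j < n ] 𝟙 (Q? j)                             ∎
  where open ≡-Reasoning

-- Strengthen the predicate by "different from the head `x`": the tail still satisfies it, and the
-- indicator of `x` supplies the missing 1.
length≤count : ∀ {n p} {P : Pred (Fin n) p} (P? : Decidable₁ P) {xs} →
               Unique xs → All P xs → length xs ≤ ∑[ i < n ] 𝟙 (P? i)
length≤count P? [] [] = z≤n
length≤count {n} P? {x ∷ xs} (x∉xs ∷ xs!) (Px ∷ Pxs) = begin
  suc (length xs)                                        ≤⟨ s≤s (length≤count other? xs! (All.zip (Pxs , x∉xs))) ⟩
  1 + ∑[ i < n ] 𝟙 (other? i)                            ≡⟨ cong (_+ ∑[ i < n ] 𝟙 (other? i)) (sum-𝟙-≟ x) ⟨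
  ∑[ i < n ] 𝟙 (x ≟ i) + ∑[ i < n ] 𝟙 (other? i)         ≡⟨ ∑-distrib-+ (λ i → 𝟙 (x ≟ i)) (λ i → 𝟙 (other? i)) ⟨
  ∑[ i < n ] (𝟙 (x ≟ i) + 𝟙 (other? i))                  ≤⟨ sum-mono-≤ {n} bound ⟩
  ∑[ i < n ] 𝟙 (P? i)                                    ∎
  where
  open ℕ.≤-Reasoning
  other? = λ i → P? i ×-dec ¬? (x ≟ i)
  bound : ∀ i → 𝟙 (x ≟ i) + 𝟙 (other? i) ≤ 𝟙 (P? i)
  bound i with x ≟ i | P? i
  ... | yes _    | yes _  = ℕ.≤-refl
  ... | yes refl | no ¬Px = contradiction Px ¬Px
  ... | no _     | yes _  = ℕ.≤-refl
  ... | no _     | no _   = z≤n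

length-filter-cartesianProduct : ∀ {a b} {A : Set a} {B : Set b} {p} {P : Pred (A × B) p}
  (P? : Decidable₁ P) {m n} (f : Fin m → A) (g : Fin n → B) →
  length (filter P? (cartesianProduct (List.tabulate f) (List.tabulate g))) ≡
  ∑[ i < m ] ∑[ j < n ] 𝟙 (P? (f i , g j))
length-filter-cartesianProduct P? {zero}  f g = refl
length-filter-cartesianProduct P? {suc m} f g =
  trans (cong length (List.filter-++ P? row _))
 (trans (List.length-++ (filter P? row))
        (cong₂ _+_ (trans (cong (length ∘ filter P?) (List.map-tabulate g (f zero ,_)))
                          (length-filter-tabulate (λ j → f zero , g j)))
                   (length-filter-cartesianProduct P? (f ∘ suc) g)))
  where
  row = List.map (f zero ,_) (List.tabulate g)
  length-filter-tabulate : ∀ {n} h → length (filter P? (List.tabulate h)) ≡ ∑[ j < n ] 𝟙 (P? (h j))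
  length-filter-tabulate {zero}  h = refl
  length-filter-tabulate {suc n} h with P? (h zero)
  ... | yes _ = cong suc (length-filter-tabulate (h ∘ suc))
  ... | no _  = length-filter-tabulate (h ∘ suc)

-- Doubled and shifted so that neither division nor truncated subtraction occurs.
2*[nC2] : ∀ n → 2 * (suc n C 2) ≡ suc n * n
2*[nC2] zero    = refl
2*[nC2] (suc n) = begin
  2 * (suc (suc n) C 2)         ≡⟨ cong (2 *_) (nCk+nC[k+1]≡[n+1]C[k+1] (suc n) 1) ⟨
  2 * (suc n C 1 + suc n C 2)   ≡⟨ cong (λ t → 2 * (t + suc n C 2)) (nC1≡n (suc n)) ⟩
  2 * (suc n + suc n C 2)       ≡⟨ ℕ.*-distribˡ-+ 2 (suc n) _ ⟩
  2 * suc n + 2 * (suc n C 2)   ≡⟨ cong (2 * suc n +_) (2*[nC2] n) ⟩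
  2 * suc n + suc n * n         ≡⟨ square n ⟩
  suc (suc n) * suc n           ∎
  where
  open ≡-Reasoning
  square : ∀ n → 2 * suc n + suc n * n ≡ suc (suc n) * suc n
  square = solve-∀

-- Counting non-adjacent pairs

module Missing {n} (G : Graph n) where
  open Graph G hiding (size; Connected)

  Missing : Fin n → Fin n → Set
  Missing i j = i ≢ j × ¬ i ~ j

  missing? : ∀ i j → Dec (Missing i j)
  missing? i j = ¬? (i ≟ j) ×-dec ¬? (i ~? j)

  missing-sym : ∀ {i j} → Missing i j → Missing j i
  missing-sym (i≢j , i≁j) = i≢j ∘ sym , i≁j ∘ ~-sym

  trichotomy : ∀ i j → 𝟙 (i ~? j) + 𝟙 (missing? i j) + 𝟙 (i ≟ j) ≡ 1
  trichotomy i j with i ~? j | i ≟ j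
  ... | yes i~j | yes i≡j = contradiction i~j (~-irrefl i≡j)
  ... | yes _   | no _    = refl
  ... | no _    | yes _   = refl
  ... | no _    | no _    = refl

  missing : ℕ
  missing = ∑[ i < n ] ∑[ j < n ] 𝟙 (missing? i j)

  -- `edges` lists an edge under its smaller endpoint, so an ordered adjacent pair is counted by
  -- exactly one of `edge i j` and `edge j i`.
  ∑∑~≡2*size : ∑[ i < n ] ∑[ j < n ] 𝟙 (i ~? j) ≡ 2 * size G
  ∑∑~≡2*size = begin
    ∑[ i < n ] ∑[ j < n ] 𝟙 (i ~? j)              ≡⟨ ∑∑-cong split ⟩
    ∑[ i < n ] ∑[ j < n ] (edge i j + edge j i)   ≡⟨ ∑∑-distrib-+ edge _ ⟩
    ∑[ i < n ] ∑[ j < n ] edge i j + ∑[ i < n ] ∑[ j < n ] edge j i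
      ≡⟨ cong₂ _+_ size≡ (trans (∑-comm (λ i j → edge j i)) (trans size≡ (sym (ℕ.+-identityʳ _)))) ⟩
    2 * size G                                    ∎
    where
    open ≡-Reasoning
    edge? : ∀ i j → Dec (i Fin.< j × i ~ j)
    edge? i j = (i <? j) ×-dec (i ~? j)
    edge : Fin n → Fin n → ℕ
    edge i j = 𝟙 (edge? i j)
    size≡ : ∑[ i < n ] ∑[ j < n ] edge i j ≡ size G
    size≡ = sym (length-filter-cartesianProduct (λ (u , v) → edge? u v) (λ i → i) (λ j → j))
    split : ∀ i j → 𝟙 (i ~? j) ≡ edge i j + edge j i
    split i j = case i ~? j of λ where
      (no i≁j) → trans (𝟙-no (i ~? j) i≁j)
        (sym (cong₂ _+_ (𝟙-no (edge? i j) (i≁j ∘ proj₂)) (𝟙-no (edge? j i) (i≁j ∘ ~-sym ∘ proj₂))))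
      (yes i~j) → trans (𝟙-yes (i ~? j) i~j) (sym (case Fin.<-cmp i j of λ where
        (tri< i<j _ j≮i) → cong₂ _+_ (𝟙-yes (edge? i j) (i<j , i~j)) (𝟙-no (edge? j i) (j≮i ∘ proj₁))
        (tri≈ _ i≡j _)   → contradiction i~j (~-irrefl i≡j)
        (tri> i≮j _ j<i) → cong₂ _+_ (𝟙-no (edge? i j) (i≮j ∘ proj₁)) (𝟙-yes (edge? j i) (j<i , ~-sym i~j))))

  2*size+missing+n : 2 * size G + missing + n ≡ n * n
  2*size+missing+n = begin
    2 * size G + missing + n
      ≡⟨ cong₂ (λ s t → s + missing + t) ∑∑~≡2*size (trans (sum-cong-≗ {n} sum-𝟙-≟) (trans (sum-const n 1) (ℕ.*-identityʳ n))) ⟨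
    ∑[ i < n ] ∑[ j < n ] 𝟙 (i ~? j) + missing + ∑[ i < n ] ∑[ j < n ] 𝟙 (i ≟ j)
      ≡⟨ cong (_+ ∑[ i < n ] ∑[ j < n ] 𝟙 (i ≟ j)) (∑∑-distrib-+ (λ i j → 𝟙 (i ~? j)) (λ i j → 𝟙 (missing? i j))) ⟨
    ∑[ i < n ] ∑[ j < n ] (𝟙 (i ~? j) + 𝟙 (missing? i j)) + ∑[ i < n ] ∑[ j < n ] 𝟙 (i ≟ j)
      ≡⟨ ∑∑-distrib-+ (λ i j → 𝟙 (i ~? j) + 𝟙 (missing? i j)) (λ i j → 𝟙 (i ≟ j)) ⟨
    ∑[ i < n ] ∑[ j < n ] (𝟙 (i ~? j) + 𝟙 (missing? i j) + 𝟙 (i ≟ j))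
      ≡⟨ ∑∑-cong trichotomy ⟩
    ∑[ i < n ] ∑[ j < n ] 1
      ≡⟨ trans (sum-cong-≗ {n} (λ _ → trans (sum-const n 1) (ℕ.*-identityʳ n))) (sum-const n n) ⟩
    n * n ∎
    where open ≡-Reasoning

  -- The bound is n(n - 1) - (n - 2)(n - 3) - 4 = 4n - 10, twice the number 2n - 5 of unordered
  -- pairs.
  missing≤ : n ≥ 3 → size G ≥ ((n ∸ 2) C 2) + 2 → missing + 10 ≤ 4 * n
  missing≤ (s≤s (s≤s (s≤s {n = p} _))) size≥ = ℕ.+-cancelˡ-≤ (suc p * p + 4 + n) (missing + 10) (4 * n) (begin
    suc p * p + 4 + n + (missing + 10)              ≡⟨ cong (λ t → t + 4 + n + (missing + 10)) (2*[nC2] p) ⟨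
    2 * (suc p C 2) + 4 + n + (missing + 10)        ≡⟨ shuffle (suc p C 2) missing n ⟩
    2 * (suc p C 2 + 2) + missing + n + 10
      ≤⟨ ℕ.+-monoˡ-≤ 10 (ℕ.+-monoˡ-≤ n (ℕ.+-monoˡ-≤ missing (ℕ.*-monoʳ-≤ 2 size≥))) ⟩
    2 * size G + missing + n + 10                   ≡⟨ cong (_+ 10) 2*size+missing+n ⟩
    n * n + 10                                      ≡⟨ expand p ⟩
    suc p * p + 4 + n + 4 * n                       ∎)
    where
    open ℕ.≤-Reasoning
    shuffle : ∀ c m n → 2 * c + 4 + n + (m + 10) ≡ 2 * (c + 2) + m + n + 10
    shuffle = solve-∀
    expand : ∀ p → (3 + p) * (3 + p) + 10 ≡ suc p * p + 4 + (3 + p) + 4 * (3 + p)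
    expand = solve-∀

  degree : Fin n → ℕ
  degree i = ∑[ j < n ] 𝟙 (i ~? j)

  nonDegree : Fin n → ℕ
  nonDegree i = ∑[ j < n ] 𝟙 (missing? i j)

  degree+nonDegree+1 : ∀ i → degree i + nonDegree i + 1 ≡ n
  degree+nonDegree+1 i = begin
    degree i + nonDegree i + 1
      ≡⟨ cong (degree i + nonDegree i +_) (sum-𝟙-≟ i) ⟨
    degree i + nonDegree i + ∑[ j < n ] 𝟙 (i ≟ j)
      ≡⟨ cong (_+ ∑[ j < n ] 𝟙 (i ≟ j)) (∑-distrib-+ (λ j → 𝟙 (i ~? j)) (λ j → 𝟙 (missing? i j))) ⟨
    ∑[ j < n ] (𝟙 (i ~? j) + 𝟙 (missing? i j)) + ∑[ j < n ] 𝟙 (i ≟ j)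
      ≡⟨ ∑-distrib-+ (λ j → 𝟙 (i ~? j) + 𝟙 (missing? i j)) (λ j → 𝟙 (i ≟ j)) ⟨
    ∑[ j < n ] (𝟙 (i ~? j) + 𝟙 (missing? i j) + 𝟙 (i ≟ j))
      ≡⟨ sum-cong-≗ {n} (trichotomy i) ⟩
    ∑[ j < n ] 1
      ≡⟨ trans (sum-const n 1) (ℕ.*-identityʳ n) ⟩
    n ∎
    where open ≡-Reasoning

  module Outside {u v : Fin n} (u≢v : u ≢ v) where

    Inner : Fin n → Set
    Inner i = i ≢ u × i ≢ v

    inner? : ∀ i → Dec (Inner i)
    inner? i = ¬? (i ≟ u) ×-dec ¬? (i ≟ v)

    sum-split : ∀ (f : Fin n → ℕ) → sum f ≡ f u + f v + ∑[ i < n ] (𝟙 (inner? i) * f i)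
    sum-split f = begin
      sum f
        ≡⟨ sum-cong-≗ {n} split ⟩
      ∑[ i < n ] (𝟙 (u ≟ i) * f i + 𝟙 (v ≟ i) * f i + 𝟙 (inner? i) * f i)
        ≡⟨ ∑-distrib-+ (λ i → 𝟙 (u ≟ i) * f i + 𝟙 (v ≟ i) * f i) (λ i → 𝟙 (inner? i) * f i) ⟩
      ∑[ i < n ] (𝟙 (u ≟ i) * f i + 𝟙 (v ≟ i) * f i) + rest
        ≡⟨ cong (_+ rest) (∑-distrib-+ (λ i → 𝟙 (u ≟ i) * f i) (λ i → 𝟙 (v ≟ i) * f i)) ⟩
      ∑[ i < n ] (𝟙 (u ≟ i) * f i) + ∑[ i < n ] (𝟙 (v ≟ i) * f i) + rest
        ≡⟨ cong (_+ rest) (cong₂ _+_ (sum-𝟙-≟-* u f) (sum-𝟙-≟-* v f)) ⟩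
      f u + f v + rest ∎
      where
      open ≡-Reasoning
      rest = ∑[ i < n ] (𝟙 (inner? i) * f i)
      split : ∀ i → f i ≡ 𝟙 (u ≟ i) * f i + 𝟙 (v ≟ i) * f i + 𝟙 (inner? i) * f i
      split i with u ≟ i | v ≟ i | i ≟ u | i ≟ v
      ... | yes u≡i | yes v≡i | _       | _       = contradiction (trans u≡i (sym v≡i)) u≢v
      ... | yes u≡i | no _    | no i≢u  | _       = contradiction (sym u≡i) i≢u
      ... | yes _   | no _    | yes _   | _       = solve (f i)
        where solve : ∀ x → x ≡ x + 0 + 0 + 0
              solve = solve-∀
      ... | no u≢i  | _       | yes i≡u | _       = contradiction (sym i≡u) u≢i
      ... | no _    | yes _   | no _    | yes _   = solve (f i)
        where solve : ∀ x → x ≡ x + 0 + 0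
              solve = solve-∀
      ... | no _    | yes v≡i | no _    | no i≢v  = contradiction (sym v≡i) i≢v
      ... | no _    | no v≢i  | no _    | yes i≡v = contradiction (sym i≡v) v≢i
      ... | no _    | no _    | no _    | no _    = sym (ℕ.+-identityʳ (f i))

    InnerMissing : Fin n → Fin n → Set
    InnerMissing i j = Inner i × Inner j × Missing i j

    innerMissing? : ∀ i j → Dec (InnerMissing i j)
    innerMissing? i j = inner? i ×-dec inner? j ×-dec missing? i j

    innerMissing-sym : ∀ {i j} → InnerMissing i j → InnerMissing j i
    innerMissing-sym (in-i , in-j , m) = in-j , in-i , missing-sym m

    innerMissing : ℕ
    innerMissing = ∑[ i < n ] ∑[ j < n ] 𝟙 (innerMissing? i j)

    -- Rows and columns of u and v in the matrix of non-adjacent pairs. The entries (u , v) and (v ,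
    -- u) lie in both a row and a column, hence the 2 on the left.
    missing-split : Missing u v →
      missing + 2 ≡ 2 * nonDegree u + 2 * nonDegree v + innerMissing
    missing-split uv = begin
      missing + 2
        ≡⟨ cong (_+ 2) (sum-split nonDegree) ⟩
      nonDegree u + nonDegree v + ∑[ i < n ] (ι i * nonDegree i) + 2
        ≡⟨ cong (λ t → nonDegree u + nonDegree v + t + 2) inner-rows ⟩
      nonDegree u + nonDegree v + (to u + to v + innerMissing) + 2
        ≡⟨ regroup (nonDegree u) (nonDegree v) (to u) (to v) innerMissing ⟩
      nonDegree u + nonDegree v + (1 + to u) + (1 + to v) + innerMissing
        ≡⟨ cong₂ (λ s t → nonDegree u + nonDegree v + s + t + innerMissing) to-u to-v ⟨
      nonDegree u + nonDegree v + nonDegree u + nonDegree v + innerMissing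
        ≡⟨ double (nonDegree u) (nonDegree v) innerMissing ⟩
      2 * nonDegree u + 2 * nonDegree v + innerMissing ∎
      where
      open ≡-Reasoning
      ι = λ i → 𝟙 (inner? i)
      m = λ i j → 𝟙 (missing? i j)
      to : Fin n → ℕ
      to w = ∑[ i < n ] (ι i * m w i)
      m-sym : ∀ i j → m i j ≡ m j i
      m-sym i j = 𝟙-cong (missing? i j) (missing? j i) missing-sym missing-sym
      m-irrefl : ∀ i → m i i ≡ 0
      m-irrefl i = 𝟙-no (missing? i i) (λ (i≢i , _) → i≢i refl)
      to-u : nonDegree u ≡ 1 + to u
      to-u = trans (sum-split (m u)) (cong (_+ to u) (cong₂ _+_ (m-irrefl u) (𝟙-yes (missing? u v) uv)))
      to-v : nonDegree v ≡ 1 + to v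
      to-v = trans (sum-split (m v)) (cong (_+ to v) (cong₂ _+_ (𝟙-yes (missing? v u) (missing-sym uv)) (m-irrefl v)))
      row : ∀ i → ι i * nonDegree i ≡ ι i * m u i + ι i * m v i + ∑[ j < n ] 𝟙 (innerMissing? i j)
      row i = begin
        ι i * nonDegree i
          ≡⟨ cong (ι i *_) (sum-split (m i)) ⟩
        ι i * (m i u + m i v + ∑[ j < n ] (ι j * m i j))
          ≡⟨ ℕ.*-distribˡ-+ (ι i) (m i u + m i v) _ ⟩
        ι i * (m i u + m i v) + ι i * ∑[ j < n ] (ι j * m i j)
          ≡⟨ cong₂ _+_ (trans (cong (ι i *_) (cong₂ _+_ (m-sym i u) (m-sym i v))) (ℕ.*-distribˡ-+ (ι i) (m u i) (m v i)))
                       (*-distribˡ-sum {n} (ι i) (λ j → ι j * m i j)) ⟩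
        ι i * m u i + ι i * m v i + ∑[ j < n ] (ι i * (ι j * m i j))
          ≡⟨ cong (ι i * m u i + ι i * m v i +_) (sum-cong-≗ {n} (λ j →
               trans (𝟙-× (inner? i) (inner? j ×-dec missing? i j)) (cong (ι i *_) (𝟙-× (inner? j) (missing? i j))))) ⟨
        ι i * m u i + ι i * m v i + ∑[ j < n ] 𝟙 (innerMissing? i j) ∎
      inner-rows : ∑[ i < n ] (ι i * nonDegree i) ≡ to u + to v + innerMissing
      inner-rows = begin
        ∑[ i < n ] (ι i * nonDegree i)
          ≡⟨ sum-cong-≗ {n} row ⟩
        ∑[ i < n ] (ι i * m u i + ι i * m v i + ∑[ j < n ] 𝟙 (innerMissing? i j))
          ≡⟨ ∑-distrib-+ (λ i → ι i * m u i + ι i * m v i) (λ i → ∑[ j < n ] 𝟙 (innerMissing? i j)) ⟩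
        ∑[ i < n ] (ι i * m u i + ι i * m v i) + innerMissing
          ≡⟨ cong (_+ innerMissing) (∑-distrib-+ (λ i → ι i * m u i) (λ i → ι i * m v i)) ⟩
        to u + to v + innerMissing ∎
      regroup : ∀ a b s t c → a + b + (s + t + c) + 2 ≡ a + b + (1 + s) + (1 + t) + c
      regroup = solve-∀
      double : ∀ a b c → a + b + a + b + c ≡ 2 * a + 2 * b + c
      double = solve-∀

    -- An orientation-insensitive count: D marks inner non-adjacent pairs, each
    -- of them in at most one of its two orientations.
    Packing : (Fin n → Fin n → ℕ) → Set
    Packing D = ∀ i j → D i j + D j i ≤ 𝟙 (innerMissing? i j)

    -- The budget d(u) + d(v) - 2 for non-adjacent pairs away from u and v. Non-degrees are n - 1
    -- minus degrees, so the terms in n cancel and only the degrees of u and v remain.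
    packing-bound : missing + 10 ≤ 4 * n → Missing u v → ∀ D → Packing D →
      ∑[ i < n ] ∑[ j < n ] D i j + 2 ≤ degree u + degree v
    packing-bound missing≤ uv D packing = ℕ.*-cancelˡ-≤ 2 (ℕ.+-cancelˡ-≤ (2 * ru + 2 * rv + 4) _ _ (begin
      2 * ru + 2 * rv + 4 + 2 * (∑D + 2)       ≡⟨ regroup ru rv ∑D ⟩
      2 * ru + 2 * rv + (∑D + ∑D) + 8          ≤⟨ ℕ.+-monoˡ-≤ 8 (ℕ.+-monoʳ-≤ (2 * ru + 2 * rv) 2∑D≤) ⟩
      2 * ru + 2 * rv + innerMissing + 8       ≡⟨ cong (_+ 8) (missing-split uv) ⟨
      missing + 2 + 8                          ≡⟨ ℕ.+-assoc missing 2 8 ⟩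
      missing + 10                             ≤⟨ missing≤ ⟩
      4 * n                                    ≡⟨ quadruple n ⟩
      2 * n + 2 * n                            ≡⟨ cong₂ (λ s t → 2 * s + 2 * t) (degree+nonDegree+1 u) (degree+nonDegree+1 v) ⟨
      2 * (degree u + ru + 1) + 2 * (degree v + rv + 1)   ≡⟨ regroup′ (degree u) (degree v) ru rv ⟩
      2 * ru + 2 * rv + 4 + 2 * (degree u + degree v)     ∎))
      where
      open ℕ.≤-Reasoning
      ru = nonDegree u
      rv = nonDegree v
      ∑D = ∑[ i < n ] ∑[ j < n ] D i j
      2∑D≤ : ∑D + ∑D ≤ innerMissing
      2∑D≤ = begin
        ∑D + ∑D                                        ≡⟨ cong (∑D +_) (∑-comm D) ⟩
        ∑D + ∑[ j < n ] ∑[ i < n ] D i j               ≡⟨ ∑∑-distrib-+ D (λ i j → D j i) ⟨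
        ∑[ i < n ] ∑[ j < n ] (D i j + D j i)          ≤⟨ ∑∑-mono-≤ packing ⟩
        innerMissing                                   ∎
      regroup : ∀ a b d → 2 * a + 2 * b + 4 + 2 * (d + 2) ≡ 2 * a + 2 * b + (d + d) + 8
      regroup = solve-∀
      regroup′ : ∀ a b s t → 2 * (a + s + 1) + 2 * (b + t + 1) ≡ 2 * s + 2 * t + 4 + 2 * (a + b)
      regroup′ = solve-∀
      quadruple : ∀ n → 4 * n ≡ 2 * n + 2 * n
      quadruple = solve-∀

    relation-packing : ∀ {R : Fin n → Fin n → Set} (R? : ∀ i j → Dec (R i j)) →
      (∀ {i j} → R i j → InnerMissing i j) → (∀ {i j} → R i j → ¬ R j i) →
      Packing (λ i j → 𝟙 (R? i j))
    relation-packing R? R⇒missing R-asym i j with R? i j | R? j i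
    ... | yes Rij | yes Rji = contradiction Rji (R-asym Rij)
    ... | yes Rij | no _    = ℕ.≤-reflexive (sym (𝟙-yes (innerMissing? i j) (R⇒missing Rij)))
    ... | no _    | yes Rji = ℕ.≤-reflexive (sym (𝟙-yes (innerMissing? i j) (innerMissing-sym (R⇒missing Rji))))
    ... | no _    | no _    = z≤n

    insert : (p q : Fin n) → (Fin n → Fin n → ℕ) → Fin n → Fin n → ℕ
    insert p q D i j = 𝟙 ((p ≟ i) ×-dec (q ≟ j)) + D i j

    insert-packing : ∀ {p q D} → InnerMissing p q → D p q ≡ 0 → D q p ≡ 0 →
      Packing D → Packing (insert p q D)
    insert-packing {p} {q} {D} pq@(_ , _ , p≢q , _) Dpq≡0 Dqp≡0 packing i j =
      bound ((p ≟ i) ×-dec (q ≟ j)) ((p ≟ j) ×-dec (q ≟ i))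
      where
      bound : (d : Dec (p ≡ i × q ≡ j)) (e : Dec (p ≡ j × q ≡ i)) →
              𝟙 d + D i j + (𝟙 e + D j i) ≤ 𝟙 (innerMissing? i j)
      bound (yes (refl , refl)) (yes (p≡q , _)) = contradiction p≡q p≢q
      bound (yes (refl , refl)) (no _) rewrite Dpq≡0 | Dqp≡0 =
        ℕ.≤-reflexive (sym (𝟙-yes (innerMissing? p q) pq))
      bound (no _) (yes (refl , refl)) rewrite Dpq≡0 | Dqp≡0 =
        ℕ.≤-reflexive (sym (𝟙-yes (innerMissing? q p) (innerMissing-sym pq)))
      bound (no _) (no _) = packing i j

    ∑∑-insert : ∀ p q D →
      ∑[ i < n ] ∑[ j < n ] insert p q D i j ≡ suc (∑[ i < n ] ∑[ j < n ] D i j)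
    ∑∑-insert p q D = trans (∑∑-distrib-+ (λ i j → 𝟙 ((p ≟ i) ×-dec (q ≟ j))) D)
      (cong (_+ ∑[ i < n ] ∑[ j < n ] D i j) (trans (∑∑-row p (q ≟_)) (sum-𝟙-≟ q)))

    infix 4 _#_
    -- Difference as unordered pairs, so that two marks never fall on the same non-adjacent pair in
    -- opposite orientations.
    _#_ : (e f : Fin n × Fin n) → Set
    (p , q) # (r , s) = ¬ (p ≡ r × q ≡ s) × ¬ (p ≡ s × q ≡ r)

    marks : List (Fin n × Fin n) → Fin n → Fin n → ℕ
    marks []            _ _ = 0
    marks ((p , q) ∷ L)     = insert p q (marks L)

    marks≡0 : ∀ {p q L} → All ((p , q) #_) L → marks L p q ≡ 0 × marks L q p ≡ 0
    marks≡0 [] = refl , refl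
    marks≡0 {p} {q} {(r , s) ∷ L} ((pq≢rs , pq≢sr) ∷ all#) with marks≡0 all#
    ... | pq≡0 , qp≡0 =
      cong₂ _+_ (𝟙-no ((r ≟ p) ×-dec (s ≟ q)) λ (r≡p , s≡q) → pq≢rs (sym r≡p , sym s≡q)) pq≡0 ,
      cong₂ _+_ (𝟙-no ((r ≟ q) ×-dec (s ≟ p)) λ (r≡q , s≡p) → pq≢sr (sym s≡p , sym r≡q)) qp≡0

    marks-packing : ∀ {L} → AllPairs _#_ L → All (λ (p , q) → InnerMissing p q) L → Packing (marks L)
    marks-packing []             []        i j = z≤n
    marks-packing {(p , q) ∷ L} (all# ∷ L#) (m ∷ ms) i j =
      insert-packing {p} {q} {marks L} m (proj₁ (marks≡0 all#)) (proj₂ (marks≡0 all#)) (marks-packing L# ms) i j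

    ∑∑-marks : ∀ L → ∑[ i < n ] ∑[ j < n ] marks L i j ≡ length L
    ∑∑-marks []            = sum-zero {n} (λ _ → sum-zero {n} (λ _ → refl))
    ∑∑-marks ((p , q) ∷ L) = trans (∑∑-insert p q (marks L)) (cong suc (∑∑-marks L))

-- The extremal structure around a distant pair

module Structure {n} (G : Graph n) where
  open Graph G hiding (size; Connected)
  open Missing G

  -- The situation of a pair u, v that no rainbow path of length at most 3 joins:
  -- x ~ y with x ∈ N(u), y ∈ N(v) then forces the edges ux and vy to have the
  -- same colour, so the edges between N(u) and N(v) form a matching.
  record Distant (u v : Fin n) : Set where
    field
      u≢v    : u ≢ v
      u≁v    : ¬ u ~ v
      apart  : ∀ {w} → u ~ w → ¬ v ~ w
      matchʳ : ∀ {x y y′} → u ~ x → v ~ y → v ~ y′ → x ~ y → x ~ y′ → y ≡ y′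
      matchˡ : ∀ {x x′ y} → u ~ x → u ~ x′ → v ~ y → x ~ y → x′ ~ y → x ≡ x′

    missing-uv : Missing u v
    missing-uv = u≢v , u≁v

    open Outside u≢v public

    N[u]-inner : ∀ {x} → u ~ x → Inner x
    N[u]-inner u~x = (λ { refl → ~-irrefl refl u~x }) , (λ { refl → u≁v u~x })

    N[v]-inner : ∀ {y} → v ~ y → Inner y
    N[v]-inner v~y = (λ { refl → u≁v (~-sym v~y) }) , (λ { refl → ~-irrefl refl v~y })

    N[u]≢N[v] : ∀ {x y} → u ~ x → v ~ y → x ≢ y
    N[u]≢N[v] u~x v~y refl = apart u~x v~y

    across : ∀ {x y} → u ~ x → v ~ y → ¬ x ~ y → InnerMissing x y
    across u~x v~y x≁y = N[u]-inner u~x , N[v]-inner v~y , N[u]≢N[v] u~x v~y , x≁y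

    across-# : ∀ {x y x′ y′} → u ~ x → v ~ y → u ~ x′ → v ~ y′ → ¬ (x ≡ x′ × y ≡ y′) → (x , y) # (x′ , y′)
    across-# u~x v~y u~x′ v~y′ ne = ne , λ (x≡y′ , _) → N[u]≢N[v] u~x v~y′ x≡y′

  Distant-sym : ∀ {u v} → Distant u v → Distant v u
  Distant-sym d = record
    { u≢v    = u≢v ∘ sym
    ; u≁v    = u≁v ∘ ~-sym
    ; apart  = λ v~w u~w → apart u~w v~w
    ; matchʳ = λ v~x u~y u~y′ x~y x~y′ → matchˡ u~y u~y′ v~x (~-sym x~y) (~-sym x~y′)
    ; matchˡ = λ v~x v~x′ u~y x~y x′~y → matchʳ u~y v~x v~x′ (~-sym x~y) (~-sym x′~y)
    }
    where open Distant d

  -- The tight configuration for d(u) = 1: the budget d(v) - 1 is spent on x against the neighbours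
  -- of v other than y, which leaves every other inner pair adjacent.
  record PendantPair (u v : Fin n) : Set where
    field
      distant : Distant u v
      {x y}   : Fin n
      u~x     : u ~ x
      only-x  : ∀ {t} → u ~ t → t ≡ x
      v~y     : v ~ y
      x~y     : x ~ y
    open Distant distant public
    field
      clique  : ∀ {p q} → Inner p → Inner q → p ≢ q →
                p ~ q ⊎ (p ≡ x × v ~ q × q ≢ y) ⊎ (q ≡ x × v ~ p × p ≢ y)

  -- The tight configuration for d(u) = d(v) = 2: the budget 2 is spent on x₀y₁ and x₁y₀.
  record TwinPair (u v : Fin n) : Set where
    field
      distant     : Distant u v
      {x₀ x₁ y₀ y₁} : Fin n
      u~x₀        : u ~ x₀
      u~x₁        : u ~ x₁
      x₀≢x₁       : x₀ ≢ x₁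
      only-x      : ∀ {t} → u ~ t → t ≡ x₀ ⊎ t ≡ x₁
      v~y₀        : v ~ y₀
      v~y₁        : v ~ y₁
      y₀≢y₁       : y₀ ≢ y₁
      only-y      : ∀ {t} → v ~ t → t ≡ y₀ ⊎ t ≡ y₁
      x₀~y₀       : x₀ ~ y₀
      x₁~y₁       : x₁ ~ y₁
      x₀≁y₁       : ¬ x₀ ~ y₁
      x₁≁y₀       : ¬ x₁ ~ y₀
    open Distant distant public
    field
      clique      : ∀ {p q} → Inner p → Inner q → p ≢ q → (p , q) # (x₀ , y₁) → (p , q) # (x₁ , y₀) → p ~ q

  module _ (missing≤4n : missing + 10 ≤ 4 * n) where

    -- Each neighbour of u has at most one neighbour in N(v), so at least d(u)(d(v) - 1) pairs
    -- between N(u) and N(v) are non-adjacent, and they must fit into the budget.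
    degree-product : ∀ {u v} → Distant u v → degree u * degree v + 2 ≤ degree u + (degree u + degree v)
    degree-product {u} {v} d = begin
      degree u * degree v + 2              ≤⟨ ℕ.+-monoˡ-≤ 2 product≤ ⟩
      degree u + ∑R + 2                    ≡⟨ ℕ.+-assoc (degree u) ∑R 2 ⟩
      degree u + (∑R + 2)                  ≤⟨ ℕ.+-monoʳ-≤ (degree u) (packing-bound missing≤4n missing-uv (λ i j → 𝟙 (R? i j))
                                                (relation-packing R? (λ (u~i , v~j , i≁j) → across u~i v~j i≁j)
                                                                     (λ (u~i , _) (_ , v~i , _) → apart u~i v~i))) ⟩
      degree u + (degree u + degree v)     ∎
      where
      open ℕ.≤-Reasoning
      open Distant d
      R? : ∀ i j → Dec (u ~ i × v ~ j × ¬ i ~ j)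
      R? i j = (u ~? i) ×-dec (v ~? j) ×-dec ¬? (i ~? j)
      ∑R = ∑[ i < n ] ∑[ j < n ] 𝟙 (R? i j)
      row : ∀ i → 𝟙 (u ~? i) * degree v ≤ 𝟙 (u ~? i) + ∑[ j < n ] 𝟙 (R? i j)
      row i with u ~? i in eq
      ... | no _    = z≤n
      ... | yes u~i = begin
        1 * degree v
          ≡⟨ ℕ.*-identityˡ (degree v) ⟩
        ∑[ j < n ] 𝟙 (v ~? j)
          ≤⟨ sum-mono-≤ {n} (λ j → bound (v ~? j) (i ~? j)) ⟩
        ∑[ j < n ] (𝟙 ((v ~? j) ×-dec (i ~? j)) + 𝟙 ((v ~? j) ×-dec ¬? (i ~? j)))
          ≡⟨ ∑-distrib-+ (λ j → 𝟙 ((v ~? j) ×-dec (i ~? j))) (λ j → 𝟙 ((v ~? j) ×-dec ¬? (i ~? j))) ⟩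
        ∑[ j < n ] 𝟙 ((v ~? j) ×-dec (i ~? j)) + ∑[ j < n ] 𝟙 ((v ~? j) ×-dec ¬? (i ~? j))
          ≤⟨ ℕ.+-monoˡ-≤ _ (sum-𝟙-≤1 {n} (λ j → (v ~? j) ×-dec (i ~? j))
               (λ (v~y , i~y) (v~y′ , i~y′) → matchʳ u~i v~y v~y′ i~y i~y′)) ⟩
        1 + ∑[ j < n ] 𝟙 ((v ~? j) ×-dec ¬? (i ~? j)) ∎
        where
        bound : ∀ {p q} {P : Set p} {Q : Set q} (P? : Dec P) (Q? : Dec Q) →
                𝟙 P? ≤ 𝟙 (P? ×-dec Q?) + 𝟙 (P? ×-dec ¬? Q?)
        bound (no _)  _       = z≤n
        bound (yes _) (yes _) = s≤s z≤n
        bound (yes _) (no _)  = s≤s z≤n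
      product≤ : degree u * degree v ≤ degree u + ∑R
      product≤ = begin
        degree u * degree v
          ≡⟨ *-distribʳ-sum {n} (degree v) (λ i → 𝟙 (u ~? i)) ⟩
        ∑[ i < n ] (𝟙 (u ~? i) * degree v)
          ≤⟨ sum-mono-≤ {n} row ⟩
        ∑[ i < n ] (𝟙 (u ~? i) + ∑[ j < n ] 𝟙 (R? i j))
          ≡⟨ ∑-distrib-+ (λ i → 𝟙 (u ~? i)) (λ i → ∑[ j < n ] 𝟙 (R? i j)) ⟩
        degree u + ∑R ∎

    pendant : ∀ {u v x} → Distant u v → u ~ x → (∀ {t} → u ~ t → t ≡ x) → PendantPair u v
    pendant {u} {v} {x} d u~x only-x = case any? (λ y → (v ~? y) ×-dec (x ~? y)) of λ where
        -- Here x misses all of N(v): `degree v` marked pairs against a budget of at most `degree v`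
        -- - 1.
        (no ¬∃y) → contradiction
          (begin-strict
            1 + degree v                                          <⟨ ℕ.n<1+n _ ⟩
            2 + degree v                                          ≡⟨ ℕ.+-comm 2 (degree v) ⟩
            degree v + 2                                          ≡⟨ cong (_+ 2) (∑∑-row x (v ~?_)) ⟨
            ∑[ i < n ] ∑[ j < n ] 𝟙 ((x ≟ i) ×-dec (v ~? j)) + 2
              ≤⟨ packing-bound missing≤4n missing-uv (λ i j → 𝟙 ((x ≟ i) ×-dec (v ~? j)))
                   (relation-packing (λ i j → (x ≟ i) ×-dec (v ~? j))
                     (λ { {j = j} (refl , v~j) → across u~x v~j (λ x~j → ¬∃y (j , v~j , x~j)) })
                     (λ { (refl , v~j) (refl , v~i) → apart u~x v~i })) ⟩
            degree u + degree v                                   ≤⟨ ℕ.+-monoˡ-≤ (degree v) degree≤1 ⟩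
            1 + degree v                                          ∎)
          (ℕ.<-irrefl refl)
        (yes (y , v~y , x~y)) → record
          { distant = d ; u~x = u~x ; only-x = only-x ; v~y = v~y ; x~y = x~y
          ; clique = clique v~y x~y }
      where
      open ℕ.≤-Reasoning
      open Distant d
      degree≤1 : degree u ≤ 1
      degree≤1 = sum-𝟙-≤1 {n} (u ~?_) (λ u~i u~j → trans (only-x u~i) (sym (only-x u~j)))
      module _ {y} (v~y : v ~ y) (x~y : x ~ y) where
        other? : ∀ j → Dec (v ~ j × j ≢ y)
        other? j = (v ~? j) ×-dec ¬? (j ≟ y)
        R? : ∀ i j → Dec (x ≡ i × v ~ j × j ≢ y)
        R? i j = (x ≟ i) ×-dec other? j
        others = ∑[ j < n ] 𝟙 (other? j)
        R-packing : Packing (λ i j → 𝟙 (R? i j))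
        R-packing = relation-packing R?
          (λ { (refl , v~j , j≢y) → across u~x v~j (λ x~j → j≢y (matchʳ u~x v~j v~y x~j x~y)) })
          (λ { (refl , v~j , _) (refl , v~x , _) → apart u~x v~x })
        degree≤ : degree v ≤ 1 + others
        degree≤ = begin
          degree v                                                    ≤⟨ sum-mono-≤ {n} bound ⟩
          ∑[ j < n ] (𝟙 (y ≟ j) + 𝟙 (other? j))                      ≡⟨ ∑-distrib-+ (λ j → 𝟙 (y ≟ j)) (λ j → 𝟙 (other? j)) ⟩
          ∑[ j < n ] 𝟙 (y ≟ j) + others                              ≡⟨ cong (_+ others) (sum-𝟙-≟ y) ⟩
          1 + others                                                  ∎
          where
          bound : ∀ j → 𝟙 (v ~? j) ≤ 𝟙 (y ≟ j) + 𝟙 (other? j)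
          bound j with v ~? j | y ≟ j | j ≟ y
          ... | no _  | _       | _       = z≤n
          ... | yes _ | yes _   | _       = s≤s z≤n
          ... | yes _ | no _    | no _    = s≤s z≤n
          ... | yes _ | no y≢j  | yes j≡y = contradiction (sym j≡y) y≢j
        clique : ∀ {p q} → Inner p → Inner q → p ≢ q →
                 p ~ q ⊎ (p ≡ x × v ~ q × q ≢ y) ⊎ (q ≡ x × v ~ p × p ≢ y)
        clique {p} {q} in-p in-q p≢q with p ~? q | R? p q | R? q p
        ... | yes p~q | _                    | _                    = inj₁ p~q
        ... | no _    | yes (x≡p , v~q , q≢y) | _                    = inj₂ (inj₁ (sym x≡p , v~q , q≢y))
        ... | no _    | no _                 | yes (x≡q , v~p , p≢y) = inj₂ (inj₂ (sym x≡q , v~p , p≢y))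
        -- The pairs in `R?` already number at least `degree v` - 1 and exhaust the budget; p and q
        -- would exceed it.
        ... | no p≁q  | no ¬Rpq              | no ¬Rqp              = contradiction
            (begin-strict
              1 + (1 + others)                                          <⟨ ℕ.n<1+n _ ⟩
              suc (2 + others)                                          ≡⟨ cong suc (ℕ.+-comm 2 others) ⟩
              suc others + 2                                            ≡⟨ cong (λ t → suc t + 2) (∑∑-row x other?) ⟨
              suc (∑[ i < n ] ∑[ j < n ] 𝟙 (R? i j)) + 2                ≡⟨ cong (_+ 2) (∑∑-insert p q (λ i j → 𝟙 (R? i j))) ⟨
              ∑[ i < n ] ∑[ j < n ] insert p q (λ i j → 𝟙 (R? i j)) i j + 2
                ≤⟨ packing-bound missing≤4n missing-uv (insert p q (λ i j → 𝟙 (R? i j)))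
                     (insert-packing {p} {q} {λ i j → 𝟙 (R? i j)} (in-p , in-q , p≢q , p≁q)
                       (𝟙-no (R? p q) ¬Rpq) (𝟙-no (R? q p) ¬Rqp) R-packing) ⟩
              degree u + degree v                                       ≤⟨ ℕ.+-mono-≤ degree≤1 degree≤ ⟩
              1 + (1 + others)                                          ∎)
            (ℕ.<-irrefl refl)

    -- The last hypothesis rearranges to (a - 2)(b - 1) ≤ 0.
    2≤a⇒2≤b⇒a≤2 : ∀ {a b} → 2 ≤ a → 2 ≤ b → a * b + 2 ≤ b + (b + a) → a ≤ 2
    2≤a⇒2≤b⇒a≤2 {suc (suc p)} {suc (suc q)} _ _ ab≤ = s≤s (s≤s (ℕ.+-cancelˡ-≤ (p + 2 * q + 6) p 0 (begin
      p + 2 * q + 6 + p              ≤⟨ ℕ.m≤m+n _ (p * q) ⟩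
      p + 2 * q + 6 + p + p * q      ≡⟨ expand p q ⟩
      (2 + p) * (2 + q) + 2          ≤⟨ ab≤ ⟩
      2 + q + (2 + q + (2 + p))      ≡⟨ expand′ p q ⟩
      p + 2 * q + 6 + 0              ∎)))
      where
      open ℕ.≤-Reasoning
      expand : ∀ p q → p + 2 * q + 6 + p + p * q ≡ (2 + p) * (2 + q) + 2
      expand = solve-∀
      expand′ : ∀ p q → 2 + q + (2 + q + (2 + p)) ≡ p + 2 * q + 6 + 0
      expand′ = solve-∀
    2≤a⇒2≤b⇒a≤2 {suc zero}          (s≤s ())
    2≤a⇒2≤b⇒a≤2 {suc (suc _)} {suc zero} _ (s≤s ())

    two-neighbours⇒2≤degree : ∀ {u x x′} → u ~ x → u ~ x′ → x ≢ x′ → 2 ≤ degree u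
    two-neighbours⇒2≤degree {u} u~x u~x′ x≢x′ =
      length≤count (u ~?_) ((x≢x′ ∷ []) ∷ [] ∷ []) (u~x ∷ u~x′ ∷ [])

    no-third-neighbour : ∀ {u x x′ t} → degree u ≤ 2 → u ~ x → u ~ x′ → x ≢ x′ → u ~ t → t ≡ x ⊎ t ≡ x′
    no-third-neighbour {u} {x} {x′} {t} degree≤2 u~x u~x′ x≢x′ u~t = case ((t ≟ x) , (t ≟ x′)) of λ where
      (yes t≡x , _)       → inj₁ t≡x
      (no _ , yes t≡x′)   → inj₂ t≡x′
      (no t≢x , no t≢x′)  → contradiction
        (ℕ.≤-trans (length≤count (u ~?_) ((t≢x ∷ t≢x′ ∷ []) ∷ (x≢x′ ∷ []) ∷ [] ∷ []) (u~t ∷ u~x ∷ u~x′ ∷ [])) degree≤2)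
        (λ { (s≤s (s≤s ())) })

    -- `degree-product` in both directions forces both degrees down to 2, so the budget is 2. A
    -- matching leaves at least two of the four cross pairs non-adjacent; any third non-adjacent
    -- pair, across or elsewhere, is a contradiction.
    twin : ∀ {u v x₀ x₁ y₀ y₁} → Distant u v → u ~ x₀ → u ~ x₁ → x₀ ≢ x₁ → v ~ y₀ → v ~ y₁ → y₀ ≢ y₁ → TwinPair u v
    twin {u} {v} {x₀} {x₁} {y₀} {y₁} d u~x₀ u~x₁ x₀≢x₁ v~y₀ v~y₁ y₀≢y₁ =
      case ((x₀ ~? y₀) , (x₀ ~? y₁) , (x₁ ~? y₀)) of λ where
        (yes x₀~y₀ , _ , _) → matched v~y₀ v~y₁ y₀≢y₁ x₀~y₀
        (no _ , yes x₀~y₁ , _) → matched v~y₁ v~y₀ (y₀≢y₁ ∘ sym) x₀~y₁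
        (no x₀≁y₀ , no x₀≁y₁ , yes x₁~y₀) → too-many
          (across u~x₀ v~y₀ x₀≁y₀ ∷ across u~x₀ v~y₁ x₀≁y₁ ∷
           across u~x₁ v~y₁ (λ x₁~y₁ → y₀≢y₁ (matchʳ u~x₁ v~y₀ v~y₁ x₁~y₀ x₁~y₁)) ∷ [])
          ((across-# u~x₀ v~y₀ u~x₀ v~y₁ (y₀≢y₁ ∘ proj₂) ∷ across-# u~x₀ v~y₀ u~x₁ v~y₁ (x₀≢x₁ ∘ proj₁) ∷ []) ∷
           (across-# u~x₀ v~y₁ u~x₁ v~y₁ (x₀≢x₁ ∘ proj₁) ∷ []) ∷ [] ∷ [])
        (no x₀≁y₀ , no x₀≁y₁ , no x₁≁y₀) → too-many
          (across u~x₀ v~y₀ x₀≁y₀ ∷ across u~x₀ v~y₁ x₀≁y₁ ∷ across u~x₁ v~y₀ x₁≁y₀ ∷ [])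
          ((across-# u~x₀ v~y₀ u~x₀ v~y₁ (y₀≢y₁ ∘ proj₂) ∷ across-# u~x₀ v~y₀ u~x₁ v~y₀ (x₀≢x₁ ∘ proj₁) ∷ []) ∷
           (across-# u~x₀ v~y₁ u~x₁ v~y₀ (x₀≢x₁ ∘ proj₁) ∷ []) ∷ [] ∷ [])
      where
      open Distant d
      2≤a = two-neighbours⇒2≤degree u~x₀ u~x₁ x₀≢x₁
      2≤b = two-neighbours⇒2≤degree v~y₀ v~y₁ y₀≢y₁
      a≤2 : degree u ≤ 2
      a≤2 = 2≤a⇒2≤b⇒a≤2 2≤a 2≤b
        (subst (λ t → t + 2 ≤ degree v + (degree v + degree u)) (ℕ.*-comm (degree v) (degree u)) (degree-product (Distant-sym d)))
      b≤2 : degree v ≤ 2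
      b≤2 = 2≤a⇒2≤b⇒a≤2 2≤b 2≤a
        (subst (λ t → t + 2 ≤ degree u + (degree u + degree v)) (ℕ.*-comm (degree u) (degree v)) (degree-product d))
      too-many : ∀ {a} {A : Set a} {e f g} → All (λ (p , q) → InnerMissing p q) (e ∷ f ∷ g ∷ []) →
        AllPairs _#_ (e ∷ f ∷ g ∷ []) → A
      too-many {e = e} {f} {g} ms L# = contradiction
        (ℕ.≤-trans (subst (λ t → t + 2 ≤ degree u + degree v) (∑∑-marks (e ∷ f ∷ g ∷ []))
                     (packing-bound missing≤4n missing-uv (marks (e ∷ f ∷ g ∷ [])) (marks-packing L# ms)))
                   (ℕ.+-mono-≤ a≤2 b≤2))
        (ℕ.<-irrefl refl)
      matched : ∀ {y y′} → v ~ y → v ~ y′ → y ≢ y′ → x₀ ~ y → TwinPair u v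
      matched {y} {y′} v~y v~y′ y≢y′ x₀~y = record
        { distant = d ; u~x₀ = u~x₀ ; u~x₁ = u~x₁ ; x₀≢x₁ = x₀≢x₁
        ; only-x = no-third-neighbour a≤2 u~x₀ u~x₁ x₀≢x₁
        ; v~y₀ = v~y ; v~y₁ = v~y′ ; y₀≢y₁ = y≢y′
        ; only-y = no-third-neighbour b≤2 v~y v~y′ y≢y′
        ; x₀~y₀ = x₀~y
        ; x₁~y₁ = case (x₁ ~? y′) of λ where
            (yes x₁~y′) → x₁~y′
            (no x₁≁y′)  → too-many (m₀ ∷ m₁ ∷ across u~x₁ v~y′ x₁≁y′ ∷ [])
              ((m# ∷ across-# u~x₀ v~y′ u~x₁ v~y′ (x₀≢x₁ ∘ proj₁) ∷ []) ∷
               (across-# u~x₁ v~y u~x₁ v~y′ (y≢y′ ∘ proj₂) ∷ []) ∷ [] ∷ [])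
        ; x₀≁y₁ = x₀≁y′ ; x₁≁y₀ = x₁≁y
        ; clique = λ {p} {q} in-p in-q p≢q #₀ #₁ → case (p ~? q) of λ where
            (yes p~q) → p~q
            (no p≁q)  → too-many ((in-p , in-q , p≢q , p≁q) ∷ m₀ ∷ m₁ ∷ [])
              ((#₀ ∷ #₁ ∷ []) ∷ (m# ∷ []) ∷ [] ∷ [])
        }
        where
        x₀≁y′ : ¬ x₀ ~ y′
        x₀≁y′ x₀~y′ = y≢y′ (matchʳ u~x₀ v~y v~y′ x₀~y x₀~y′)
        x₁≁y : ¬ x₁ ~ y
        x₁≁y x₁~y = x₀≢x₁ (matchˡ u~x₀ u~x₁ v~y x₀~y x₁~y)
        m₀ = across u~x₀ v~y′ x₀≁y′
        m₁ = across u~x₁ v~y x₁≁y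
        m# = across-# u~x₀ v~y′ u~x₁ v~y (x₀≢x₁ ∘ proj₁)

    structure : ∀ {u v x y} → Distant u v → u ~ x → v ~ y → PendantPair u v ⊎ PendantPair v u ⊎ TwinPair u v
    structure {u} {v} {x} {y} d u~x v~y = case (another u x , another v y) of λ where
        (no ¬x′ , _) → inj₁ (pendant d u~x (only ¬x′))
        (yes _ , no ¬y′) → inj₂ (inj₁ (pendant (Distant-sym d) v~y (only ¬y′)))
        (yes (x′ , u~x′ , x≢x′) , yes (y′ , v~y′ , y≢y′)) → inj₂ (inj₂ (twin d u~x u~x′ x≢x′ v~y v~y′ y≢y′))
      where
      another : ∀ s t → Dec (∃[ t′ ] (s ~ t′ × t ≢ t′))
      another s t = any? (λ t′ → (s ~? t′) ×-dec ¬? (t ≟ t′))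
      only : ∀ {s t} → ¬ (∃[ t′ ] (s ~ t′ × t ≢ t′)) → ∀ {t′} → s ~ t′ → t′ ≡ t
      only {s} {t} ¬t′ {t′} s~t′ with t′ ≟ t
      ... | yes t′≡t = t′≡t
      ... | no t′≢t  = contradiction (t′ , s~t′ , t′≢t ∘ sym) ¬t′

-- Renaming vertices and colouring by sums

-- Moves prescribed distinct vertices to the front. An injective endomap is enough, since labels
-- only have to tell vertices apart.
straighten : ∀ k {m} (f : Fin k → Fin (k + m)) → Injective _≡_ _≡_ f →
             ∃[ σ ] (Injective _≡_ _≡_ σ × ∀ i → σ (f i) ≡ i ↑ˡ m)
straighten zero    f f-inj = (λ i → i) , (λ eq → eq) , λ ()
straighten (suc k) {m} f f-inj = σ , σ-inj , σ-f
  where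
  f₀≢f₊ : ∀ j → f zero ≢ f (suc j)
  f₀≢f₊ j eq with () ← f-inj eq
  rest = straighten k (λ j → punchOut (f₀≢f₊ j))
    (λ eq → Fin.suc-injective (f-inj (Fin.punchOut-injective (f₀≢f₊ _) (f₀≢f₊ _) eq)))
  σ′     = proj₁ rest
  σ′-inj = proj₁ (proj₂ rest)
  σ′-f   = proj₂ (proj₂ rest)
  σ : Fin (suc (k + m)) → Fin (suc (k + m))
  σ i with f zero ≟ i
  ... | yes _  = zero
  ... | no f₀≢i = suc (σ′ (punchOut f₀≢i))
  σ-inj : Injective _≡_ _≡_ σ
  σ-inj {i} {j} eq with f zero ≟ i | f zero ≟ j
  ... | yes f₀≡i | yes f₀≡j = trans (sym f₀≡i) f₀≡j
  ... | no f₀≢i  | no f₀≢j  = Fin.punchOut-injective f₀≢i f₀≢j (σ′-inj (Fin.suc-injective eq))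
  σ-f : ∀ i → σ (f i) ≡ i ↑ˡ m
  σ-f zero with f zero ≟ f zero
  ... | yes _     = refl
  ... | no f₀≢f₀  = contradiction refl f₀≢f₀
  σ-f (suc i) with f zero ≟ f (suc i)
  ... | yes f₀≡fᵢ = contradiction f₀≡fᵢ (f₀≢f₊ i)
  ... | no _      = cong suc (trans (cong σ′ (Fin.punchOut-cong (f zero) refl)) (σ′-f i))

+-%-cancelˡ : ∀ {m} (a b c : Fin (suc m)) → (toℕ a + toℕ b) % suc m ≡ (toℕ a + toℕ c) % suc m → b ≡ c
+-%-cancelˡ {m} a b c eq = Fin.toℕ-injective
  (trans (sym (recover b)) (trans (cong (λ r → (a⁻ % suc m + r) % suc m) eq) (recover c)))
  where
  open ≡-Reasoning
  a⁻ = suc m ∸ toℕ a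
  recover : ∀ x → (a⁻ % suc m + (toℕ a + toℕ x) % suc m) % suc m ≡ toℕ x
  recover x = begin
    (a⁻ % suc m + (toℕ a + toℕ x) % suc m) % suc m  ≡⟨ %-distribˡ-+ a⁻ (toℕ a + toℕ x) (suc m) ⟨
    (a⁻ + (toℕ a + toℕ x)) % suc m                  ≡⟨ cong (_% suc m) (ℕ.+-assoc a⁻ (toℕ a) (toℕ x)) ⟨
    (a⁻ + toℕ a + toℕ x) % suc m                    ≡⟨ cong (λ s → (s + toℕ x) % suc m) (ℕ.m∸n+n≡m (ℕ.<⇒≤ (Fin.toℕ<n a))) ⟩
    (suc m + toℕ x) % suc m                         ≡⟨ cong (_% suc m) (ℕ.+-comm (suc m) (toℕ x)) ⟩
    (toℕ x + suc m) % suc m                         ≡⟨ [m+n]%n≡m%n (toℕ x) (suc m) ⟩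
    toℕ x % suc m                                   ≡⟨ m<n⇒m%n≡m (Fin.toℕ<n x) ⟩
    toℕ x                                           ∎

HasProper : ∀ {n} → Graph n → ℕ → Set
HasProper G k = Σ[ c ∈ EdgeColouring G k ] Proper c

HasProperRainbow : ∀ {n} → Graph n → ℕ → Set
HasProperRainbow G k = Σ[ c ∈ EdgeColouring G k ] (Proper c × RainbowConnected c)

-- Taken at k = χ′ this yields prc = χ′, even if the rainbow colouring is unrelated to the given
-- one.
Upgradable : ∀ {n} → Graph n → Set
Upgradable G = ∀ k → HasProper G k → HasProperRainbow G k

module SumColouring {n m k} (G : Graph n) (g : Fin n → Fin (suc m)) (m<k : suc m ≤ k) where
  open Graph G hiding (size; Connected)

  sumColouring : EdgeColouring G k
  sumColouring = record
    { colour     = λ {i} {j} _ → sumMod i j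
    ; colour-sym = λ {i} {j} _ _ → cong (λ s → inject≤ (s mod suc m) m<k) (ℕ.+-comm (toℕ (g i)) (toℕ (g j)))
    }
    where
    sumMod : Fin n → Fin n → Fin k
    sumMod i j = inject≤ ((toℕ (g i) + toℕ (g j)) mod suc m) m<k

  -- The label of the common endpoint cancels. Labels need to separate only vertices with a common
  -- neighbour, so others may share one.
  sumColouring-proper : (∀ {i j l} → i ~ j → i ~ l → g j ≡ g l → j ≡ l) → Proper sumColouring
  sumColouring-proper locally-injective {i} {j} {l} i~j i~l j≢l eq =
    j≢l (locally-injective i~j i~l (+-%-cancelˡ (g i) (g j) (g l)
      (Fin.fromℕ<-injective _ _ (m%n<n (toℕ (g i) + toℕ (g j)) (suc m)) (m%n<n (toℕ (g i) + toℕ (g l)) (suc m))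
        (Fin.inject≤-injective m<k m<k _ _ eq))))

-- Rainbow paths in a proper colouring

module RainbowPaths {n} {G : Graph n} {k} (c : EdgeColouring G k) (proper : Proper c) where
  open Graph G hiding (size; Connected)
  open EdgeColouring c hiding (Proper; RainbowConnected)

  RainbowPath : Fin n → Fin n → Set
  RainbowPath u v = Σ[ p ∈ Walk u v ] IsRainbowPath p

  ~⇒≢ : ∀ {u v} → u ~ v → u ≢ v
  ~⇒≢ u~v refl = ~-irrefl refl u~v

  colour-irrelevant : ∀ {u v} (e e′ : u ~ v) → colour e ≡ colour e′
  colour-irrelevant e e′ = trans (colour-sym e (~-sym e)) (sym (colour-sym e′ (~-sym e)))

  consecutive : ∀ {u v w} (e : u ~ v) (f : v ~ w) → u ≢ w → colour e ≢ colour f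
  consecutive e f u≢w eq = proper (~-sym e) f u≢w (trans (colour-sym (~-sym e) e) eq)

  common-head : ∀ {u v w} (e : u ~ w) (f : v ~ w) → u ≢ v → colour e ≢ colour f
  common-head e f u≢v eq = consecutive e (~-sym f) u≢v (trans eq (colour-sym f (~-sym f)))

  -- A permutation suffices in place of an exact reversal, because `Unique` is invariant under
  -- permutation.
  vertices-revApp : ∀ {u v w} (p : Walk u v) (q : Walk u w) →
    u ∷ vertices (revApp ~-sym p q) ↭ vertices p ++ vertices q
  vertices-revApp ε q = ↭-refl
  vertices-revApp (_◅_ {u} {x} e p) q =
    prep u (↭.drop-∷ (↭-trans (vertices-revApp p (~-sym e ◅ q)) (↭.shift x (vertices p) (vertices q))))

  colours-revApp : ∀ {u v w} (p : Walk u v) (q : Walk u w) →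
    colours (revApp ~-sym p q) ↭ colours p ++ colours q
  colours-revApp ε q = ↭-refl
  colours-revApp (e ◅ p) q = ↭-trans (colours-revApp p (~-sym e ◅ q))
    (subst (λ r → colours p ++ r ∷ colours q ↭ colour e ∷ colours p ++ colours q) (colour-sym e (~-sym e))
      (↭.shift (colour e) (colours p) (colours q)))

  reverse : ∀ {u v} → RainbowPath u v → RainbowPath v u
  reverse {u} (p , path , rainbow) = Star.reverse ~-sym p ,
    Unique-resp (↭-sym vertices↭) path , Unique-resp (↭-sym colours↭) rainbow
    where
    Unique-resp : ∀ {a} {A : Set a} {xs ys : List A} → xs ↭ ys → Unique xs → Unique ys
    Unique-resp xs↭ys = ↭ₛ.Unique-resp-↭ (setoid _) (↭⇒↭ₛ xs↭ys)
    vertices↭ : vertices (Star.reverse ~-sym p) ↭ vertices p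
    vertices↭ = ↭.drop-∷ (↭-trans (vertices-revApp p ε)
      (subst (vertices p ++ (u ∷ []) ↭_) (cong (u ∷_) (List.++-identityʳ (vertices p))) (↭.shift u (vertices p) [])))
    colours↭ : colours (Star.reverse ~-sym p) ↭ colours p
    colours↭ = subst (colours (Star.reverse ~-sym p) ↭_) (List.++-identityʳ (colours p)) (colours-revApp p ε)

  path₁ : ∀ {u v} → u ~ v → RainbowPath u v
  path₁ e = e ◅ ε , (~⇒≢ e ∷ []) ∷ [] ∷ [] , [] ∷ []

  path₂ : ∀ {u x v} → u ~ x → x ~ v → u ≢ v → RainbowPath u v
  path₂ e f u≢v = e ◅ f ◅ ε ,
    (~⇒≢ e ∷ u≢v ∷ []) ∷ (~⇒≢ f ∷ []) ∷ [] ∷ [] ,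
    (consecutive e f u≢v ∷ []) ∷ [] ∷ []

  -- Properness already separates consecutive edges, so colour hypotheses concern only edges without
  -- a common vertex.
  path₃ : ∀ {u x y v} (e : u ~ x) (f : x ~ y) (g : y ~ v) →
    u ≢ y → u ≢ v → x ≢ v → colour e ≢ colour g → RainbowPath u v
  path₃ e f g u≢y u≢v x≢v e≢g = e ◅ f ◅ g ◅ ε ,
    (~⇒≢ e ∷ u≢y ∷ u≢v ∷ []) ∷ (~⇒≢ f ∷ x≢v ∷ []) ∷ (~⇒≢ g ∷ []) ∷ [] ∷ [] ,
    (consecutive e f u≢y ∷ e≢g ∷ []) ∷ (consecutive f g x≢v ∷ []) ∷ [] ∷ []

  path₄ : ∀ {u x y z v} (e : u ~ x) (f : x ~ y) (g : y ~ z) (h : z ~ v) →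
    u ≢ y → u ≢ z → u ≢ v → x ≢ z → x ≢ v → y ≢ v →
    colour e ≢ colour g → colour e ≢ colour h → colour f ≢ colour h → RainbowPath u v
  path₄ e f g h u≢y u≢z u≢v x≢z x≢v y≢v e≢g e≢h f≢h = e ◅ f ◅ g ◅ h ◅ ε ,
    (~⇒≢ e ∷ u≢y ∷ u≢z ∷ u≢v ∷ []) ∷ (~⇒≢ f ∷ x≢z ∷ x≢v ∷ []) ∷ (~⇒≢ g ∷ y≢v ∷ []) ∷ (~⇒≢ h ∷ []) ∷ [] ∷ [] ,
    (consecutive e f u≢y ∷ e≢g ∷ e≢h ∷ []) ∷ (consecutive f g x≢z ∷ f≢h ∷ []) ∷ (consecutive g h y≢v ∷ []) ∷ [] ∷ []

-- Configurations that need another colouring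

module Recolouring {n} (G : Graph n) where
  open Graph G hiding (size; Connected)

  -- In a proper colouring the edge wy has a colour different from those of xy
  -- and xw, so it can be given to the pendant edge ux.
  pendant-upgradable : ∀ {u x y w} → u ~ x → (∀ {t} → u ~ t → t ≡ x) → x ~ y → x ~ w → w ~ y →
    (∀ {t} → x ~ t → t ≡ u ⊎ t ≡ y ⊎ t ≡ w) → (∀ {t} → t ≢ u → t ≢ y → y ~ t) →
    u ≢ y → u ≢ w → Upgradable G
  pendant-upgradable {u} {x} {y} {w} u~x only-x x~y x~w w~y N[x] y~rest u≢y u≢w k (c , proper) = c′ , proper′ , rainbow
    where
    open EdgeColouring c hiding (Proper; RainbowConnected)
    module P = RainbowPaths c proper
    γ = colour w~y
    colour′ : ∀ {i j} → i ~ j → Fin k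
    colour′ {i} {j} e with i ≟ u | j ≟ u
    ... | yes _ | _     = γ
    ... | no _  | yes _ = γ
    ... | no _  | no _  = colour e
    colour′-sym : ∀ {i j} (e : i ~ j) (e′ : j ~ i) → colour′ e ≡ colour′ e′
    colour′-sym {i} {j} e e′ with i ≟ u | j ≟ u
    ... | yes _ | yes _ = refl
    ... | yes _ | no _  = refl
    ... | no _  | yes _ = refl
    ... | no _  | no _  = colour-sym e e′
    c′ : EdgeColouring G k
    c′ = record { colour = colour′ ; colour-sym = colour′-sym }
    γ-fresh : ∀ {t} (e : x ~ t) → t ≢ u → colour e ≢ γ
    γ-fresh e t≢u with N[x] e
    ... | inj₁ t≡u         = contradiction t≡u t≢u
    ... | inj₂ (inj₁ refl) = P.common-head e w~y (P.~⇒≢ x~w)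
    ... | inj₂ (inj₂ refl) = P.consecutive e w~y (P.~⇒≢ x~y)
    proper′ : Proper c′
    proper′ {i} {j} {l} e f j≢l with i ≟ u | j ≟ u | l ≟ u
    ... | yes refl | _        | _        = contradiction (trans (only-x e) (sym (only-x f))) j≢l
    ... | no _     | yes refl | yes l≡u  = contradiction (sym l≡u) j≢l
    ... | no _     | yes refl | no l≢u   rewrite only-x (~-sym e) = γ-fresh f l≢u ∘ sym
    ... | no _     | no j≢u   | yes refl rewrite only-x (~-sym f) = γ-fresh e j≢u
    ... | no _     | no _     | no _     = proper e f j≢l
    module P′ = RainbowPaths c′ proper′
    u-to : ∀ {t} → u ≢ t → P′.RainbowPath u t
    u-to {t} u≢t with t ≟ x | t ≟ y | t ≟ w
    ... | yes refl | _        | _        = P′.path₁ u~x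
    ... | no _     | yes refl | _        = P′.path₂ u~x x~y u≢t
    ... | no _     | no _     | yes refl = P′.path₂ u~x x~w u≢t
    -- The new colour of ux is that of wy, which meets yt at y; only t = w would repeat it, and w is
    -- reached directly from x.
    ... | no t≢x   | no t≢y   | no t≢w   = P′.path₃ u~x x~y y~t u≢y u≢t (t≢x ∘ sym) distinct
      where
      y~t = y~rest (u≢t ∘ sym) t≢y
      distinct : colour′ u~x ≢ colour′ y~t
      distinct with u ≟ u | y ≟ u | t ≟ u
      ... | no u≢u | _       | _       = contradiction refl u≢u
      ... | yes _  | yes y≡u | _       = contradiction (sym y≡u) u≢y
      ... | yes _  | no _    | yes t≡u = contradiction (sym t≡u) u≢t
      ... | yes _  | no _    | no _    = P.consecutive w~y y~t (t≢w ∘ sym)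
    rainbow : RainbowConnected c′
    rainbow s t s≢t with s ≟ u | t ≟ u
    ... | yes refl | _        = u-to s≢t
    ... | no _     | yes refl = P′.reverse (u-to (s≢t ∘ sym))
    -- Away from u everything is adjacent to y, so two edges through y suffice.
    ... | no s≢u   | no t≢u with s ≟ y | t ≟ y
    ...   | yes refl | _        = P′.path₁ (y~rest t≢u (s≢t ∘ sym))
    ...   | no _     | yes refl = P′.path₁ (~-sym (y~rest s≢u s≢t))
    ...   | no s≢y   | no t≢y   = P′.path₂ (~-sym (y~rest s≢u s≢y)) (y~rest t≢u t≢y) s≢t

record Labelling {n} (m : ℕ) (x y u v : Fin n) : Set where
  field
    label     : Fin n → Fin (suc (suc (suc m)))
    x↦0       : label x ≡ 0F
    y↦1       : label y ≡ 1F
    u↦0       : label u ≡ 0F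
    v↦1       : label v ≡ 1F
    injective : ∀ {i j} → label i ≡ label j →
                i ≡ j ⊎ (i ≡ x × j ≡ u ⊎ i ≡ u × j ≡ x) ⊎ (i ≡ y × j ≡ v ⊎ i ≡ v × j ≡ y)

-- The fifth vertex w serves to make the modulus n - 2 at least 3, so that the labels 0 and 2 are
-- distinct.
labelling : ∀ {n} {x y u v w : Fin n} → Uniqueᵥ (x ∷ y ∷ u ∷ v ∷ w ∷ []) →
            ∃[ m ] (n ≡ 5 + m × Labelling m x y u v)
labelling {n} {x} {y} {u} {v} {w} distinct = case ℕ.m≤n⇒∃[o]m+o≡n (Fin.injective⇒≤ f-inj) of λ where
    (m , refl) → m , refl , fromStraight m (straighten 5 f f-inj)
  where
  f : Fin 5 → Fin n
  f = lookup (x ∷ y ∷ u ∷ v ∷ w ∷ [])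
  f-inj : Injective _≡_ _≡_ f
  f-inj = lookup-injective distinct _ _
  fromStraight : ∀ m {f : Fin 5 → Fin (5 + m)} →
    ∃[ σ ] (Injective _≡_ _≡_ σ × ∀ i → σ (f i) ≡ i ↑ˡ m) →
    Labelling m (f 0F) (f 1F) (f 2F) (f 3F)
  fromStraight m {f} (σ , σ-inj , σ-f) = record
    { label = fold ∘ σ
    ; x↦0 = cong fold (σ-f 0F) ; y↦1 = cong fold (σ-f 1F)
    ; u↦0 = cong fold (σ-f 2F) ; v↦1 = cong fold (σ-f 3F)
    ; injective = injective }
    where
    -- Positions 2 and 3, held by u and v, are merged with those of x and y; the rest move down by
    -- two.
    fold : Fin (5 + m) → Fin (3 + m)
    fold 0F                      = 0F
    fold 1F                      = 1F
    fold 2F                      = 0F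
    fold 3F                      = 1F
    fold (suc (suc (suc (suc i)))) = Fin.suc (suc i)
    at : ∀ k {i} → σ i ≡ k ↑ˡ m → i ≡ f k
    at k eq = σ-inj (trans eq (sym (σ-f k)))
    injective : ∀ {i j} → fold (σ i) ≡ fold (σ j) →
      i ≡ j ⊎ (i ≡ f 0F × j ≡ f 2F ⊎ i ≡ f 2F × j ≡ f 0F) ⊎ (i ≡ f 1F × j ≡ f 3F ⊎ i ≡ f 3F × j ≡ f 1F)
    injective {i} {j} eq with σ i in σi | σ j in σj
    ... | 0F | 0F = inj₁ (trans (at 0F σi) (sym (at 0F σj)))
    ... | 0F | 2F = inj₂ (inj₁ (inj₁ (at 0F σi , at 2F σj)))
    ... | 2F | 0F = inj₂ (inj₁ (inj₂ (at 2F σi , at 0F σj)))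
    ... | 2F | 2F = inj₁ (trans (at 2F σi) (sym (at 2F σj)))
    ... | 1F | 1F = inj₁ (trans (at 1F σi) (sym (at 1F σj)))
    ... | 1F | 3F = inj₂ (inj₂ (inj₁ (at 1F σi , at 3F σj)))
    ... | 3F | 1F = inj₂ (inj₂ (inj₂ (at 3F σi , at 1F σj)))
    ... | 3F | 3F = inj₁ (trans (at 3F σi) (sym (at 3F σj)))
    ... | 0F | 1F with () ← eq
    ... | 0F | 3F with () ← eq
    ... | 0F | suc (suc (suc (suc _))) with () ← eq
    ... | 2F | 1F with () ← eq
    ... | 2F | 3F with () ← eq
    ... | 2F | suc (suc (suc (suc _))) with () ← eq
    ... | suc (suc (suc (suc _))) | suc (suc (suc (suc _))) =
      inj₁ (σ-inj (trans σi (trans (cong (λ k → Fin.suc (suc k)) eq) (sym σj))))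

-- The edges from x to all vertices but x and v need distinct colours; `punchIn` skips the two. This
-- shows that the palette has room for sums modulo n - 2.
almost-dominating⇒≤colours : ∀ {n m k} → n ≡ 2 + m → (G : Graph n) (let open Graph G)
  (c : EdgeColouring G k) → Proper c → ∀ {x v} → x ≢ v → (∀ {t} → t ≢ x → t ≢ v → x ~ t) → m ≤ k
almost-dominating⇒≤colours {m = m} {k} refl G c proper {x} {v} x≢v x-rest =
  Fin.injective⇒≤ {f = λ i → colour (edge i)} λ {i} {j} eq →
    decidable-stable (i ≟ j) λ i≢j →
      proper (edge i) (edge j) (i≢j ∘ Fin.punchIn-injective v′ i j ∘ Fin.punchIn-injective x _ _) eq
  where
  open Graph G hiding (size; Connected)
  open EdgeColouring c hiding (Proper; RainbowConnected)
  v′ : Fin (suc m)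
  v′ = punchOut x≢v
  edge : ∀ i → x ~ punchIn x (punchIn v′ i)
  edge i = x-rest (Fin.punchInᵢ≢i x _) λ eq →
    Fin.punchInᵢ≢i v′ i (Fin.punchIn-injective x _ _ (trans eq (sym (Fin.punchIn-punchOut x≢v))))

module DoublePendant {n} (G : Graph n) where
  open Graph G hiding (size; Connected)
  open Missing G

  -- G is a complete graph with pendant edges ux and vy. Labelling the vertices
  -- of the complete graph by ℤ/(n - 2) with x ↦ 0 and y ↦ 1, the edge ij gets the
  -- colour i + j, and a pendant edge at i the colour 2i that is missing there;
  -- giving u and v the labels of x and y makes this the same formula.
  clique-upgradable : ∀ {u v x y w} (u≢v : u ≢ v) → let open Outside u≢v in
    u ~ x → (∀ {t} → u ~ t → t ≡ x) → v ~ y → (∀ {t} → v ~ t → t ≡ y) → x ≢ y →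
    Inner x → Inner y → Inner w → w ≢ x → w ≢ y →
    (∀ {p q} → Inner p → Inner q → p ≢ q → p ~ q) → Upgradable G
  clique-upgradable {u} {v} {x} {y} {w} u≢v u~x only-x v~y only-y x≢y in-x in-y in-w w≢x w≢y clique k (c , proper) =
    case labelling ((x≢y ∷ proj₁ in-x ∷ proj₂ in-x ∷ w≢x ∘ sym ∷ []) ∷
                    (proj₁ in-y ∷ proj₂ in-y ∷ w≢y ∘ sym ∷ []) ∷
                    (u≢v ∷ proj₁ in-w ∘ sym ∷ []) ∷ (proj₂ in-w ∘ sym ∷ []) ∷ [] ∷ []) of λ where
      (m , n≡ , labels) → fromLabelling m n≡ labels
    where
    open Outside u≢v
    open EdgeColouring c hiding (Proper; RainbowConnected)
    x-rest : ∀ {t} → t ≢ x → t ≢ v → x ~ t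
    x-rest {t} t≢x t≢v = case t ≟ u of λ where
      (yes refl) → ~-sym u~x
      (no t≢u)   → clique in-x (t≢u , t≢v) (t≢x ∘ sym)
    y-rest : ∀ {t} → t ≢ y → t ≢ u → y ~ t
    y-rest {t} t≢y t≢u = case t ≟ v of λ where
      (yes refl) → ~-sym v~y
      (no t≢v)   → clique in-y (t≢u , t≢v) (t≢y ∘ sym)
    fromLabelling : ∀ m → n ≡ 5 + m → Labelling m x y u v → HasProperRainbow G k
    fromLabelling m n≡ labels = sumColouring , proper′ , rainbow
      where
      open Labelling labels
      palette : 3 + m ≤ k
      palette = almost-dominating⇒≤colours n≡ G c proper (proj₂ in-x) x-rest
      open SumColouring G label palette
      -- Equal labels occur only at a pendant vertex and its support, and a common neighbour of
      -- these would be a loop at the support.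
      no-common : ∀ {i s t} → (∀ {r} → s ~ r → r ≡ t) → i ~ s → ¬ i ~ t
      no-common only i~s i~t with refl ← only (~-sym i~s) = ~-irrefl refl i~t
      proper′ : Proper sumColouring
      proper′ = sumColouring-proper λ i~j i~l eq → case injective eq of λ where
        (inj₁ j≡l)                          → j≡l
        (inj₂ (inj₁ (inj₁ (refl , refl)))) → ⊥-elim (no-common only-x i~l i~j)
        (inj₂ (inj₁ (inj₂ (refl , refl)))) → ⊥-elim (no-common only-x i~j i~l)
        (inj₂ (inj₂ (inj₁ (refl , refl)))) → ⊥-elim (no-common only-y i~l i~j)
        (inj₂ (inj₂ (inj₂ (refl , refl)))) → ⊥-elim (no-common only-y i~j i~l)
      open RainbowPaths sumColouring proper′
      u≢y = proj₁ in-y ∘ sym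
      x≢v = proj₂ in-x
      -- The end edges of u - x - y - v get 0 + 0 and 1 + 1.
      u-v : RainbowPath u v
      u-v = path₃ u~x (clique in-x in-y x≢y) (~-sym v~y) u≢y u≢v x≢v
        λ eq → 0≢2 (Fin.inject≤-injective palette palette _ _ (subst₂ sum≡ (cong₂ _,_ u↦0 x↦0) (cong₂ _,_ y↦1 v↦1) eq))
        where
        sum≡ : (p q : Fin (3 + m) × Fin (3 + m)) → Set
        sum≡ (i , j) (i′ , j′) =
          inject≤ ((toℕ i + toℕ j) mod (3 + m)) palette ≡ inject≤ ((toℕ i′ + toℕ j′) mod (3 + m)) palette
        0≢2 : _≢_ {A = Fin (3 + m)} 0F 2F
        0≢2 ()
      from-u : ∀ {t} → u ≢ t → t ≢ v → RainbowPath u t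
      from-u {t} u≢t t≢v = case t ≟ x of λ where
        (yes refl) → path₁ u~x
        (no t≢x)   → path₂ u~x (x-rest t≢x t≢v) u≢t
      from-v : ∀ {t} → v ≢ t → t ≢ u → RainbowPath v t
      from-v {t} v≢t t≢u = case t ≟ y of λ where
        (yes refl) → path₁ v~y
        (no t≢y)   → path₂ v~y (y-rest t≢y t≢u) v≢t
      rainbow : RainbowConnected sumColouring
      rainbow s t s≢t with s ≟ u | s ≟ v | t ≟ u | t ≟ v
      ... | yes refl | _        | _        | yes refl = u-v
      ... | _        | yes refl | yes refl | _        = reverse u-v
      ... | yes refl | _        | _        | no t≢v   = from-u s≢t t≢v
      ... | _        | no s≢v   | yes refl | _        = reverse (from-u (s≢t ∘ sym) s≢v)
      ... | _        | yes refl | no t≢u   | _        = from-v s≢t t≢u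
      ... | no s≢u   | _        | _        | yes refl = reverse (from-v (s≢t ∘ sym) s≢u)
      ... | no s≢u   | no s≢v   | no t≢u   | no t≢v   = path₁ (clique (s≢u , s≢v) (t≢u , t≢v) s≢t)

-- Recognising a graph from its edges and non-edges

module _ {n m} (G : Graph n) (es nes : List (Fin m × Fin m)) where
  open Graph G hiding (size; Connected)
  open Missing G using (Missing; missing-sym)
  open DecMembership (≡-dec (_≟_ {m}) (_≟_ {m})) using (_∈?_)

  covers? : Dec (∀ i j → i ≡ j ⊎ ((i , j) ∈ es ⊎ (j , i) ∈ es) ⊎ ((i , j) ∈ nes ⊎ (j , i) ∈ nes))
  covers? = all? λ i → all? λ j →
    (i ≟ j) ⊎-dec (((i , j) ∈? es) ⊎-dec ((j , i) ∈? es)) ⊎-dec (((i , j) ∈? nes) ⊎-dec ((j , i) ∈? nes))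

  -- Since every pair of indices is listed, injectivity of `f` and reflection of adjacency come for
  -- free: an edge or a non-edge has distinct endpoints. Coverage of a concrete list is settled by
  -- evaluation.
  ≅-fromEdges : {_ : True covers?} (f : Fin m → Fin n) → (∀ t → ∃[ i ] f i ≡ t) →
    All (λ (i , j) → f i ~ f j) es → All (λ (i , j) → Missing (f i) (f j)) nes → G ≅ fromEdges es
  ≅-fromEdges {covered} f surj edge non-edge =
    mk↔ₛ′ to f (λ i → f-injective (f-to (f i))) f-to ,
    λ s t → mk⇔ (λ s~t → reflect (subst₂ _~_ (sym (f-to s)) (sym (f-to t)) s~t))
                (λ e → subst₂ _~_ (f-to s) (f-to t) (preserve e))
    where
    open Graph (fromEdges es) using () renaming (_~_ to _~′_)
    to : Fin n → Fin m
    to t = proj₁ (surj t)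
    f-to : ∀ t → f (to t) ≡ t
    f-to t = proj₂ (surj t)
    preserve : ∀ {i j} → i ~′ j → f i ~ f j
    preserve (_ , inj₁ ij∈es) = All.lookup edge ij∈es
    preserve (_ , inj₂ ji∈es) = ~-sym (All.lookup edge ji∈es)
    non-edge′ : ∀ {i j} → (i , j) ∈ nes ⊎ (j , i) ∈ nes → Missing (f i) (f j)
    non-edge′ (inj₁ ij∈nes) = All.lookup non-edge ij∈nes
    non-edge′ (inj₂ ji∈nes) = missing-sym (All.lookup non-edge ji∈nes)
    f-injective : Injective _≡_ _≡_ f
    f-injective {i} {j} fi≡fj = decidable-stable (i ≟ j) λ i≢j → case toWitness covered i j of λ where
      (inj₁ i≡j)         → i≢j i≡j
      (inj₂ (inj₁ ij))   → ~-irrefl fi≡fj (preserve (i≢j , ij))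
      (inj₂ (inj₂ ij))   → proj₁ (non-edge′ ij) fi≡fj
    reflect : ∀ {i j} → f i ~ f j → i ~′ j
    reflect {i} {j} e = case toWitness covered i j of λ where
      (inj₁ refl)        → contradiction e (~-irrefl refl)
      (inj₂ (inj₁ ij))   → (λ { refl → ~-irrefl refl e }) , ij
      (inj₂ (inj₂ ij))   → contradiction e (proj₂ (non-edge′ ij))

Exceptional : ∀ {n} → Graph n → Set
Exceptional G = (G ≅ P₄ ⊎ G ≅ Z₂ ⊎ G ≅ G₆₋₃) ⊎ Upgradable G

-- Case analysis of a distant pair in a given colouring

module Analysis {n} {G : Graph n} {k} (c : EdgeColouring G k) (proper : Proper c) where
  open Graph G hiding (size; Connected)
  open EdgeColouring c hiding (Proper; RainbowConnected)
  open RainbowPaths c proper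
  open Missing G using (Missing; missing-sym; module Outside)
  open Structure G
  open Recolouring G
  open DoublePendant G

  Matched : Fin n → Fin n → Set
  Matched u v = ∀ {x y} (e : u ~ x) (f : v ~ y) → x ~ y → colour e ≡ colour f

  Matched-sym : ∀ {u v} → Matched u v → Matched v u
  Matched-sym matched e f x~y = sym (matched f e (~-sym x~y))

  -- Colours take adjacency proofs as arguments; the test uses the proofs from `_~?_`, and
  -- `colour-irrelevant` carries the result to all others.
  unmatched? : ∀ u v x y → Dec (Σ[ e ∈ u ~ x ] Σ[ f ∈ v ~ y ] (x ~ y × colour e ≢ colour f))
  unmatched? u v x y with u ~? x | v ~? y
  ... | no u≁x | _      = no (u≁x ∘ proj₁)
  ... | yes _  | no v≁y = no (v≁y ∘ proj₁ ∘ proj₂)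
  ... | yes e  | yes f  = map′ (λ r → e , f , r)
    (λ (e′ , f′ , x~y , e≢f) → x~y , λ eq → e≢f (trans (colour-irrelevant e′ e) (trans eq (colour-irrelevant f f′))))
    ((x ~? y) ×-dec ¬? (colour e ≟ colour f))

  rainbow-or-distant : ∀ {u v} → u ≢ v → RainbowPath u v ⊎ (Distant u v × Matched u v)
  rainbow-or-distant {u} {v} u≢v with u ~? v
  ... | yes u~v = inj₁ (path₁ u~v)
  ... | no u≁v with any? (λ w → (u ~? w) ×-dec (v ~? w))
  ...   | yes (w , u~w , v~w) = inj₁ (path₂ u~w (~-sym v~w) u≢v)
  ...   | no ¬common with any? (λ x → any? (λ y → unmatched? u v x y))
  ...     | yes (x , y , e , f , x~y , e≢f) = inj₁ (path₃ e x~y (~-sym f)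
              (λ { refl → u≁v (~-sym f) }) u≢v (λ { refl → u≁v e })
              (λ eq → e≢f (trans eq (colour-sym (~-sym f) f))))
  ...     | no ¬unmatched = inj₂ (distant , matched)
    where
    matched : Matched u v
    matched {x} {y} e f x~y = decidable-stable (colour e ≟ colour f) λ e≢f → ¬unmatched (x , y , e , f , x~y , e≢f)
    distant : Distant u v
    distant = record
      { u≢v = u≢v ; u≁v = u≁v
      ; apart = λ {w} u~w v~w → ¬common (w , u~w , v~w)
      -- Both vy and vy′ would carry the colour of ux, against properness at v.
      ; matchʳ = λ {_} {y} {y′} e f f′ x~y x~y′ → decidable-stable (y ≟ y′) λ y≢y′ →
          proper f f′ y≢y′ (trans (sym (matched e f x~y)) (matched e f′ x~y′))
      ; matchˡ = λ {x} {x′} e e′ f x~y x′~y → decidable-stable (x ≟ x′) λ x≢x′ →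
          proper e e′ x≢x′ (trans (matched e f x~y) (sym (matched e′ f x′~y)))
      }

  module _ {u v} (pair : PendantPair u v) (matched : Matched u v) where
    open PendantPair pair

    private
      in-x : Inner x
      in-x = N[u]-inner u~x

      in-y : Inner y
      in-y = N[v]-inner v~y

      x≢y : x ≢ y
      x≢y = ~⇒≢ x~y

      y-clique : ∀ {q} → Inner q → y ≢ q → y ~ q
      y-clique in-q y≢q = case clique in-y in-q y≢q of λ where
        (inj₁ y~q)                        → y~q
        (inj₂ (inj₁ (y≡x , _)))           → contradiction (sym y≡x) x≢y
        (inj₂ (inj₂ (_ , _ , y≢y)))       → contradiction refl y≢y

      x-clique : ∀ {w} → Inner w → w ≢ x → ¬ v ~ w → x ~ w
      x-clique in-w w≢x v≁w = case clique in-x in-w (w≢x ∘ sym) of λ where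
        (inj₁ x~w)                        → x~w
        (inj₂ (inj₁ (_ , v~w , _)))       → contradiction v~w v≁w
        (inj₂ (inj₂ (w≡x , _)))           → contradiction w≡x w≢x

      rest-clique : ∀ {p q} → Inner p → Inner q → p ≢ q → p ≢ x → q ≢ x → p ~ q
      rest-clique in-p in-q p≢q p≢x q≢x = case clique in-p in-q p≢q of λ where
        (inj₁ p~q)                        → p~q
        (inj₂ (inj₁ (p≡x , _)))           → contradiction p≡x p≢x
        (inj₂ (inj₂ (q≡x , _)))           → contradiction q≡x q≢x

      -- By `x-clique` these are neighbours of x outside N(v), the source of detours that avoid y.
      Far : Fin n → Set
      Far w = Inner w × w ≢ x × ¬ v ~ w

      far? : ∀ w → Dec (Far w)
      far? w = (¬? (w ≟ u) ×-dec ¬? (w ≟ v)) ×-dec ¬? (w ≟ x) ×-dec ¬? (v ~? w)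

      colour-at-v : ∀ {y′} (f : v ~ y′) → y′ ≢ y → colour u~x ≢ colour (~-sym f)
      colour-at-v f y′≢y eq =
        proper f v~y y′≢y (trans (colour-sym f (~-sym f)) (trans (sym eq) (matched u~x v~y x~y)))

      -- The path u - x - y - y′ - v. As ux has the colour of vy, it differs from yy′ and from vy′;
      -- only xy against vy′ is left to assume.
      path-via-y : ∀ {y′} (f : v ~ y′) → y′ ≢ y → colour x~y ≢ colour f → RainbowPath u v
      path-via-y {y′} f y′≢y xy≢f = path₄ u~x x~y y~y′ (~-sym f)
        (proj₁ in-y ∘ sym) (proj₁ (N[v]-inner f) ∘ sym) u≢v (N[u]≢N[v] u~x f) (proj₂ in-x) (proj₂ in-y)
        (λ eq → proper (~-sym v~y) y~y′ (proj₂ (N[v]-inner f) ∘ sym)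
                  (trans (colour-sym (~-sym v~y) v~y) (trans (sym (matched u~x v~y x~y)) eq)))
        (colour-at-v f y′≢y)
        (λ eq → xy≢f (trans eq (colour-sym (~-sym f) f)))
        where
        y~y′ : y ~ y′
        y~y′ = y-clique (N[v]-inner f) (y′≢y ∘ sym)

      -- The path u - x - w - y′ - v. Now vy′ has the colour of xy and hence differs from xw; only
      -- ux against wy′ is left to assume.
      path-via-w : ∀ {y′ w} (f : v ~ y′) → y′ ≢ y → colour x~y ≡ colour f →
        Far w → (w~y′ : w ~ y′) → colour u~x ≢ colour w~y′ → RainbowPath u v
      path-via-w {y′} {w} f y′≢y xy≡f (in-w , w≢x , v≁w) w~y′ ux≢wy′ = path₄ u~x x~w w~y′ (~-sym f)
        (proj₁ in-w ∘ sym) (proj₁ (N[v]-inner f) ∘ sym) u≢v (N[u]≢N[v] u~x f) (proj₂ in-x) (proj₂ in-w)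
        ux≢wy′ (colour-at-v f y′≢y)
        (λ eq → proper x~w x~y (λ { refl → v≁w v~y }) (trans eq (trans (colour-sym (~-sym f) f) (sym xy≡f))))
        where
        x~w : x ~ w
        x~w = x-clique in-w w≢x v≁w

      no-other-y : (∀ {t} → v ~ t → t ≡ y) → Exceptional G
      no-other-y only-y with any? far?
      ... | yes (w , in-w , w≢x , v≁w) = inj₂ (clique-upgradable u≢v u~x only-x v~y only-y x≢y in-x in-y in-w w≢x
              (λ { refl → v≁w v~y })
              λ in-p in-q p≢q → case clique in-p in-q p≢q of λ where
                (inj₁ p~q)                           → p~q
                (inj₂ (inj₁ (_ , v~q , q≢y)))        → contradiction (only-y v~q) q≢y
                (inj₂ (inj₂ (_ , v~p , p≢y)))        → contradiction (only-y v~p) p≢y)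
      -- Only u, x, y and v remain.
      ... | no ¬far = inj₁ (inj₁ (≅-fromEdges G ((0F , 1F) ∷ (1F , 2F) ∷ (2F , 3F) ∷ []) ((0F , 2F) ∷ (0F , 3F) ∷ (1F , 3F) ∷ [])
              (lookup (u ∷ x ∷ y ∷ v ∷ [])) all-listed
              (u~x ∷ x~y ∷ ~-sym v~y ∷ [])
              ((proj₁ in-y ∘ sym , λ u~y → apart u~y v~y) ∷ missing-uv ∷ (proj₂ in-x , apart u~x ∘ ~-sym) ∷ [])))
        where
        all-listed : ∀ t → ∃[ i ] lookup (u ∷ x ∷ y ∷ v ∷ []) i ≡ t
        all-listed t with t ≟ u | t ≟ v | t ≟ x | v ~? t
        ... | yes t≡u | _       | _       | _       = 0F , sym t≡u
        ... | no _    | yes t≡v | _       | _       = 3F , sym t≡v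
        ... | no _    | no _    | yes t≡x | _       = 1F , sym t≡x
        ... | no _    | no _    | no _    | yes v~t = 2F , sym (only-y v~t)
        ... | no t≢u  | no t≢v  | no t≢x  | no v≁t  = contradiction (t , (t≢u , t≢v) , t≢x , v≁t) ¬far

      module _ {y′} (f : v ~ y′) (y′≢y : y′ ≢ y) (only-ys : ∀ {t} → v ~ t → t ≢ y → t ≡ y′) where

        no-far : ¬ (∃[ w ] Far w) → G ≅ Z₂
        no-far ¬far = ≅-fromEdges G
          ((0F , 1F) ∷ (1F , 2F) ∷ (2F , 0F) ∷ (0F , 3F) ∷ (3F , 4F) ∷ [])
          ((0F , 4F) ∷ (1F , 3F) ∷ (1F , 4F) ∷ (2F , 3F) ∷ (2F , 4F) ∷ [])
          (lookup (y ∷ y′ ∷ v ∷ x ∷ u ∷ [])) all-listed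
          (y-clique in-y′ (y′≢y ∘ sym) ∷ ~-sym f ∷ v~y ∷ ~-sym x~y ∷ ~-sym u~x ∷ [])
          ((proj₁ in-y , λ y~u → apart (~-sym y~u) v~y) ∷
           (N[u]≢N[v] u~x f ∘ sym , λ y′~x → y′≢y (matchʳ u~x f v~y (~-sym y′~x) x~y)) ∷
           (proj₁ in-y′ , λ y′~u → apart (~-sym y′~u) f) ∷
           (proj₂ in-x ∘ sym , apart u~x) ∷
           missing-sym missing-uv ∷ [])
          where
          in-y′ = N[v]-inner f
          all-listed : ∀ t → ∃[ i ] lookup (y ∷ y′ ∷ v ∷ x ∷ u ∷ []) i ≡ t
          all-listed t with t ≟ u | t ≟ v | t ≟ x | v ~? t | t ≟ y
          ... | yes t≡u | _       | _       | _       | _       = 4F , sym t≡u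
          ... | no _    | yes t≡v | _       | _       | _       = 2F , sym t≡v
          ... | no _    | no _    | yes t≡x | _       | _       = 3F , sym t≡x
          ... | no _    | no _    | no _    | yes _   | yes t≡y = 0F , sym t≡y
          ... | no _    | no _    | no _    | yes v~t | no t≢y  = 1F , sym (only-ys v~t t≢y)
          ... | no t≢u  | no t≢v  | no t≢x  | no v≁t  | _       = contradiction (t , (t≢u , t≢v) , t≢x , v≁t) ¬far

        -- Here x has degree 3, with neighbours u, y and w, so ux can take the colour of wy.
        one-far : ∀ {w} → Far w → (∀ {w′} → Far w′ → w′ ≡ w) → Upgradable G
        one-far {w} (in-w , w≢x , v≁w) only-w = pendant-upgradable u~x only-x x~y (x-clique in-w w≢x v≁w)
          (~-sym (y-clique in-w (λ { refl → v≁w v~y })))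
          N[x]
          (λ {t} t≢u t≢y → case t ≟ v of λ where
            (yes refl) → ~-sym v~y
            (no t≢v)   → y-clique (t≢u , t≢v) (t≢y ∘ sym))
          (proj₁ in-y ∘ sym) (proj₁ in-w ∘ sym)
          where
          N[x] : ∀ {t} → x ~ t → t ≡ u ⊎ t ≡ y ⊎ t ≡ w
          N[x] {t} x~t with t ≟ u | v ~? t
          ... | yes t≡u | _       = inj₁ t≡u
          ... | no _    | yes v~t = inj₂ (inj₁ (matchʳ u~x v~t v~y x~t x~y))
          ... | no t≢u  | no v≁t  = inj₂ (inj₂ (only-w
            ((t≢u , λ { refl → apart u~x (~-sym x~t) }) , ~⇒≢ x~t ∘ sym , v≁t)))

        w~y′ : ∀ {w} → Far w → w ~ y′
        w~y′ (in-w , w≢x , v≁w) =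
          rest-clique in-w (N[v]-inner f) (λ { refl → v≁w f }) w≢x (N[u]≢N[v] u~x f ∘ sym)

        one-other-y : colour x~y ≡ colour f → RainbowPath u v ⊎ Exceptional G
        one-other-y xy≡f with any? far?
        ... | no ¬far = inj₂ (inj₁ (inj₂ (inj₁ (no-far ¬far))))
        ... | yes (w , far-w) with any? (λ w′ → far? w′ ×-dec ¬? (w′ ≟ w))
        ...   | no ¬other = inj₂ (inj₂ (one-far far-w (λ {w′} far-w′ →
                  decidable-stable (w′ ≟ w) λ w′≢w → ¬other (w′ , far-w′ , w′≢w))))
        -- The edges wy′ and w′y′ meet at y′, so at most one of them shares the colour of ux.
        ...   | yes (w′ , far-w′ , w′≢w) with colour u~x ≟ colour (w~y′ far-w)
        ...     | no ux≢wy′  = inj₁ (path-via-w f y′≢y xy≡f far-w _ ux≢wy′)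
        ...     | yes ux≡wy′ = inj₁ (path-via-w f y′≢y xy≡f far-w′ (w~y′ far-w′)
                    λ ux≡w′y′ → common-head _ (w~y′ far-w′) (w′≢w ∘ sym) (trans (sym ux≡wy′) ux≡w′y′))

    pendant-pair : RainbowPath u v ⊎ Exceptional G
    pendant-pair with any? (λ y′ → (v ~? y′) ×-dec ¬? (y′ ≟ y))
    ... | no ¬y′ = inj₂ (no-other-y λ {t} v~t → decidable-stable (t ≟ y) λ t≢y → ¬y′ (t , v~t , t≢y))
    ... | yes (y′ , f , y′≢y) with colour x~y ≟ colour f
    ...   | no xy≢f  = inj₁ (path-via-y f y′≢y xy≢f)
    -- A third neighbour of v gives an edge at v whose colour is not that of vy′, hence not that of
    -- xy.
    ...   | yes xy≡f with any? (λ y″ → (v ~? y″) ×-dec ¬? (y″ ≟ y) ×-dec ¬? (y″ ≟ y′))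
    ...     | yes (y″ , f″ , y″≢y , y″≢y′) =
                inj₁ (path-via-y f″ y″≢y (λ xy≡f″ → proper f″ f y″≢y′ (trans (sym xy≡f″) xy≡f)))
    ...     | no ¬y″ = one-other-y f y′≢y (λ {t} v~t t≢y →
                decidable-stable (t ≟ y′) λ t≢y′ → ¬y″ (t , v~t , t≢y , t≢y′)) xy≡f

  module _ {u v} (pair : TwinPair u v) (matched : Matched u v) where
    open TwinPair pair

    private
      in-x₀ = N[u]-inner u~x₀
      in-x₁ = N[u]-inner u~x₁
      in-y₀ = N[v]-inner v~y₀
      in-y₁ = N[v]-inner v~y₁

      x₀~x₁ : x₀ ~ x₁
      x₀~x₁ = clique in-x₀ in-x₁ x₀≢x₁
        ((λ (_ , x₁≡y₁) → N[u]≢N[v] u~x₁ v~y₁ x₁≡y₁) , λ (x₀≡y₁ , _) → N[u]≢N[v] u~x₀ v~y₁ x₀≡y₁)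
        ((λ (x₀≡x₁ , _) → x₀≢x₁ x₀≡x₁) , λ (x₀≡y₀ , _) → N[u]≢N[v] u~x₀ v~y₀ x₀≡y₀)

      y₀~y₁ : y₀ ~ y₁
      y₀~y₁ = clique in-y₀ in-y₁ y₀≢y₁
        ((λ (y₀≡x₀ , _) → N[u]≢N[v] u~x₀ v~y₀ (sym y₀≡x₀)) , λ (y₀≡y₁ , _) → y₀≢y₁ y₀≡y₁)
        ((λ (y₀≡x₁ , _) → N[u]≢N[v] u~x₁ v~y₀ (sym y₀≡x₁)) , λ (_ , y₁≡x₁) → N[u]≢N[v] u~x₁ v~y₁ (sym y₁≡x₁))

      -- The path u - s - t - z - v, where {s , t} = {x₀ , x₁} and tz is an edge
      -- of the matching between N(u) and N(v).
      path-via-xs : ∀ {s t z} (us : u ~ s) (ut : u ~ t) (st : s ~ t) (tz : t ~ z) (vz : v ~ z) →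
        colour us ≢ colour tz → RainbowPath u v
      path-via-xs us ut st tz vz us≢tz = path₄ us st tz (~-sym vz)
        (~⇒≢ ut) (proj₁ (N[v]-inner vz) ∘ sym) u≢v (N[u]≢N[v] us vz) (proj₂ (N[u]-inner us)) (proj₂ (N[u]-inner ut))
        us≢tz
        (λ eq → proper us ut (~⇒≢ st) (trans eq (trans (colour-sym (~-sym vz) vz) (sym (matched ut vz tz)))))
        (λ eq → common-head st ut (~⇒≢ us ∘ sym)
                  (trans eq (trans (colour-sym (~-sym vz) vz) (sym (matched ut vz tz)))))

      Other : Fin n → Set
      Other w = Inner w × w ≢ x₀ × w ≢ x₁ × w ≢ y₀ × w ≢ y₁

      other? : ∀ w → Dec (Other w)
      other? w = (¬? (w ≟ u) ×-dec ¬? (w ≟ v)) ×-dec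
        ¬? (w ≟ x₀) ×-dec ¬? (w ≟ x₁) ×-dec ¬? (w ≟ y₀) ×-dec ¬? (w ≟ y₁)

      -- The path u - x₀ - w - y₁ - v. The two coincidences help: ux₀ has the colour of x₁y₁, which
      -- meets wy₁, and vy₁ has that of x₀y₀, which meets x₀w.
      path-via-other : ∀ {w} → Other w → colour u~x₀ ≡ colour x₁~y₁ → colour u~x₁ ≡ colour x₀~y₀ → RainbowPath u v
      path-via-other {w} (in-w , w≢x₀ , w≢x₁ , w≢y₀ , w≢y₁) ux₀≡x₁y₁ ux₁≡x₀y₀ = path₄ u~x₀ x₀~w w~y₁ (~-sym v~y₁)
        (proj₁ in-w ∘ sym) (proj₁ in-y₁ ∘ sym) u≢v (N[u]≢N[v] u~x₀ v~y₁) (proj₂ in-x₀) (proj₂ in-w)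
        (λ eq → common-head x₁~y₁ w~y₁ (w≢x₁ ∘ sym) (trans (sym ux₀≡x₁y₁) eq))
        (λ eq → proper u~x₀ u~x₁ x₀≢x₁ (trans eq v-y₁))
        (λ eq → proper x₀~w x₀~y₀ w≢y₀ (trans eq (trans v-y₁ ux₁≡x₀y₀)))
        where
        v-y₁ : colour (~-sym v~y₁) ≡ colour u~x₁
        v-y₁ = trans (colour-sym (~-sym v~y₁) v~y₁) (sym (matched u~x₁ v~y₁ x₁~y₁))
        x₀~w : x₀ ~ w
        x₀~w = clique in-x₀ in-w (w≢x₀ ∘ sym)
          ((λ (_ , w≡y₁) → w≢y₁ w≡y₁) , λ (_ , w≡x₀) → w≢x₀ w≡x₀)
          ((λ (_ , w≡y₀) → w≢y₀ w≡y₀) , λ (_ , w≡x₁) → w≢x₁ w≡x₁)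
        w~y₁ : w ~ y₁
        w~y₁ = clique in-w in-y₁ w≢y₁
          ((λ (w≡x₀ , _) → w≢x₀ w≡x₀) , λ (w≡y₁ , _) → w≢y₁ w≡y₁)
          ((λ (w≡x₁ , _) → w≢x₁ w≡x₁) , λ (w≡y₀ , _) → w≢y₀ w≡y₀)

      -- Without further vertices, `G` is the triangular prism on ux₀x₁ and vy₀y₁ with the edge uv
      -- removed, which is another view of G₆.₃.
      no-other : ¬ (∃[ w ] Other w) → G ≅ G₆₋₃
      no-other ¬other = ≅-fromEdges G
        ((0F , 1F) ∷ (0F , 2F) ∷ (0F , 3F) ∷ (2F , 3F) ∷ (2F , 5F) ∷ (4F , 5F) ∷ (1F , 4F) ∷ (1F , 5F) ∷ [])
        ((0F , 4F) ∷ (0F , 5F) ∷ (1F , 2F) ∷ (1F , 3F) ∷ (2F , 4F) ∷ (3F , 4F) ∷ (3F , 5F) ∷ [])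
        (lookup (x₀ ∷ y₀ ∷ x₁ ∷ u ∷ v ∷ y₁ ∷ [])) all-listed
        (x₀~y₀ ∷ x₀~x₁ ∷ ~-sym u~x₀ ∷ ~-sym u~x₁ ∷ x₁~y₁ ∷ v~y₁ ∷ ~-sym v~y₀ ∷ y₀~y₁ ∷ [])
        ((proj₂ in-x₀ , λ x₀~v → apart u~x₀ (~-sym x₀~v)) ∷
         (N[u]≢N[v] u~x₀ v~y₁ , x₀≁y₁) ∷
         (N[u]≢N[v] u~x₁ v~y₀ ∘ sym , x₁≁y₀ ∘ ~-sym) ∷
         (proj₁ in-y₀ , λ y₀~u → apart (~-sym y₀~u) v~y₀) ∷
         (proj₂ in-x₁ , λ x₁~v → apart u~x₁ (~-sym x₁~v)) ∷
         missing-uv ∷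
         (proj₁ in-y₁ ∘ sym , λ u~y₁ → apart u~y₁ v~y₁) ∷ [])
        where
        all-listed : ∀ t → ∃[ i ] lookup (x₀ ∷ y₀ ∷ x₁ ∷ u ∷ v ∷ y₁ ∷ []) i ≡ t
        all-listed t with t ≟ u | t ≟ v | t ≟ x₀ | t ≟ x₁ | t ≟ y₀ | t ≟ y₁
        ... | yes t≡u | _ | _ | _ | _ | _ = 3F , sym t≡u
        ... | _ | yes t≡v | _ | _ | _ | _ = 4F , sym t≡v
        ... | _ | _ | yes t≡x₀ | _ | _ | _ = 0F , sym t≡x₀
        ... | _ | _ | _ | yes t≡x₁ | _ | _ = 2F , sym t≡x₁
        ... | _ | _ | _ | _ | yes t≡y₀ | _ = 1F , sym t≡y₀
        ... | _ | _ | _ | _ | _ | yes t≡y₁ = 5F , sym t≡y₁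
        ... | no t≢u | no t≢v | no t≢x₀ | no t≢x₁ | no t≢y₀ | no t≢y₁ =
          contradiction (t , (t≢u , t≢v) , t≢x₀ , t≢x₁ , t≢y₀ , t≢y₁) ¬other

    twin-pair : RainbowPath u v ⊎ Exceptional G
    twin-pair with colour u~x₀ ≟ colour x₁~y₁
    ... | no ux₀≢x₁y₁ = inj₁ (path-via-xs u~x₀ u~x₁ x₀~x₁ x₁~y₁ v~y₁ ux₀≢x₁y₁)
    ... | yes ux₀≡x₁y₁ with colour u~x₁ ≟ colour x₀~y₀
    ...   | no ux₁≢x₀y₀ = inj₁ (path-via-xs u~x₁ u~x₀ (~-sym x₀~x₁) x₀~y₀ v~y₀ ux₁≢x₀y₀)
    ...   | yes ux₁≡x₀y₀ with any? other?
    ...     | yes (w , other-w) = inj₁ (path-via-other other-w ux₀≡x₁y₁ ux₁≡x₀y₀)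
    ...     | no ¬other = inj₂ (inj₁ (inj₂ (inj₂ (no-other ¬other))))

-- Existence of the chromatic index

least : ∀ {P : ℕ → Set} → (∀ k → Dec (P k)) → ∀ {N} → P N → ∃[ k ] IsMinimum P k
least {P} P? {N} PN = case search (suc N) of λ where
    (inj₁ minimum) → minimum
    (inj₂ none)    → contradiction PN (none N (ℕ.n<1+n N))
  where
  search : ∀ M → ∃[ k ] IsMinimum P k ⊎ (∀ j → j < M → ¬ P j)
  search zero    = inj₂ λ _ ()
  search (suc M) with search M
  ... | inj₁ minimum = inj₁ minimum
  ... | inj₂ none with P? M
  ...   | yes PM = inj₁ (M , PM , λ j Pj → ℕ.≮⇒≥ λ j<M → none j j<M Pj)
  ...   | no ¬PM = inj₂ λ j j<1+M Pj → case ℕ.m≤n⇒m<n∨m≡n (ℕ.≤-pred j<1+M) of λ where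
            (inj₁ j<M)  → none j j<M Pj
            (inj₂ refl) → ¬PM Pj

module _ {n} (G : Graph n) where
  open Graph G hiding (size; Connected)

  -- A colouring as a total function on ordered pairs, free of adjacency proofs; such functions are
  -- coded by `Fin ((k ^ n) ^ n)` and can be searched.
  IsProperMap : ∀ {k} → (Fin n → Fin n → Fin k) → Set
  IsProperMap f = (∀ i j → i ~ j → f i j ≡ f j i) × (∀ i j l → i ~ j → i ~ l → j ≢ l → f i j ≢ f i l)

  properMap? : ∀ {k} (f : Fin n → Fin n → Fin k) → Dec (IsProperMap f)
  properMap? f =
    (all? λ i → all? λ j → (i ~? j) →-dec (f i j ≟ f j i)) ×-dec
    (all? λ i → all? λ j → all? λ l → (i ~? j) →-dec (i ~? l) →-dec ¬? (j ≟ l) →-dec ¬? (f i j ≟ f i l))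

  decode : ∀ {k} → Fin ((k ^ n) ^ n) → Fin n → Fin n → Fin k
  decode t i = finToFun (finToFun t i)

  encode : ∀ {k} → (Fin n → Fin n → Fin k) → Fin ((k ^ n) ^ n)
  encode f = funToFin (funToFin ∘ f)

  decode-encode : ∀ {k} (f : Fin n → Fin n → Fin k) i j → decode (encode f) i j ≡ f i j
  decode-encode f i j = trans (cong (λ r → finToFun r j) (Fin.finToFun-funToFin (funToFin ∘ f) i))
                              (Fin.finToFun-funToFin (f i) j)

  properMap⇒hasProper : ∀ {k} {f : Fin n → Fin n → Fin k} → IsProperMap f → HasProper G k
  properMap⇒hasProper {f = f} (f-sym , f-proper) =
    record { colour = λ {i} {j} _ → f i j ; colour-sym = λ e _ → f-sym _ _ e } , λ e e′ → f-proper _ _ _ e e′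

  -- Non-edges receive the default colour `zero`, which is why the palette is `suc k`.
  hasProper⇒properMap : ∀ {k} → HasProper G (suc k) → ∃[ t ] IsProperMap (decode {suc k} t)
  hasProper⇒properMap {k} (c , proper) = encode f , decoded-sym , decoded-proper
    where
    open EdgeColouring c hiding (Proper; RainbowConnected)
    f : Fin n → Fin n → Fin (suc k)
    f i j with i ~? j
    ... | yes e = colour e
    ... | no _  = zero
    decoded : ∀ {i j} (e : i ~ j) → decode (encode f) i j ≡ colour e
    decoded {i} {j} e = trans (decode-encode f i j) on-edge
      where
      on-edge : f i j ≡ colour e
      on-edge with i ~? j
      ... | yes e′ = RainbowPaths.colour-irrelevant c proper e′ e
      ... | no i≁j = contradiction e i≁j
    decoded-sym : ∀ i j → i ~ j → decode (encode f) i j ≡ decode (encode f) j i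
    decoded-sym i j e = trans (decoded e) (trans (colour-sym e (~-sym e)) (sym (decoded (~-sym e))))
    decoded-proper : ∀ i j l → i ~ j → i ~ l → j ≢ l → decode (encode f) i j ≢ decode (encode f) i l
    decoded-proper i j l e e′ j≢l eq = proper e e′ j≢l (trans (sym (decoded e)) (trans eq (decoded e′)))

  hasProper? : ∀ {s t} → s ~ t → ∀ k → Dec (HasProper G k)
  -- The given edge rules out the empty palette.
  hasProper? s~t zero    = no λ (c , _) → Fin.¬Fin0 (EdgeColouring.colour c s~t)
  hasProper? s~t (suc k) = map′ (properMap⇒hasProper ∘ proj₂) hasProper⇒properMap (any? λ t → properMap? (decode t))

  chromaticIndex : ∀ {s t} → s ~ t → ∃[ k ] IsChromaticIndex G k
  chromaticIndex {s} s~t = least (hasProper? s~t) (vertexSums n refl)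
    where
    vertexSums : ∀ m → n ≡ m → HasProper G m
    vertexSums zero    refl = contradiction s Fin.¬Fin0
    -- Sums of vertices modulo n give an upper bound from which the search can start.
    vertexSums (suc m) refl = sumColouring , sumColouring-proper (λ _ _ i≡j → i≡j)
      where open SumColouring G (λ i → i) ℕ.≤-refl

  neighbour : Connected G → ∀ {u v} → u ≢ v → ∃[ x ] u ~ x
  neighbour connected {u} {v} u≢v = case proj₁ (connected u v) of λ where
    ε       → contradiction refl u≢v
    (e ◅ _) → _ , e

-- From pairs of vertices to the theorem

∀-or : ∀ {n p q} {P : Fin n → Set p} {Q : Set q} → (∀ i → P i ⊎ Q) → (∀ i → P i) ⊎ Q
∀-or {zero}  _      = inj₁ λ ()
∀-or {suc n} P-or-Q with P-or-Q zero | ∀-or (P-or-Q ∘ suc)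
... | inj₁ P₀ | inj₁ P₊ = inj₁ λ { zero → P₀ ; (suc i) → P₊ i }
... | inj₂ q  | _       = inj₂ q
... | inj₁ _  | inj₂ q  = inj₂ q

rainbow-or-exceptional : ∀ {n} {G : Graph n} → n ≥ 3 → Connected G → size G ≥ ((n ∸ 2) C 2) + 2 →
  ∀ {k} (c : EdgeColouring G k) → Proper c → RainbowConnected c ⊎ Exceptional G
rainbow-or-exceptional {n} {G} n≥3 connected size≥ c proper = ∀-or λ u → ∀-or λ v → pair u v
  where
  open Analysis c proper
  open RainbowPaths c proper
  open Structure G
  pair : ∀ u v → (u ≢ v → RainbowPath u v) ⊎ Exceptional G
  pair u v with u ≟ v
  ... | yes u≡v = inj₁ (contradiction u≡v)
  ... | no u≢v with rainbow-or-distant u≢v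
  ...   | inj₁ path = inj₁ λ _ → path
  ...   | inj₂ (distant , matched)
    with structure (Missing.missing≤ G n≥3 size≥) distant
           (proj₂ (neighbour G connected u≢v)) (proj₂ (neighbour G connected (u≢v ∘ sym)))
  ...     | inj₁ pendant-uv        = Sum.map₁ const (pendant-pair pendant-uv matched)
  ...     | inj₂ (inj₁ pendant-vu) = Sum.map₁ (const ∘ reverse) (pendant-pair pendant-vu (Matched-sym matched))
  ...     | inj₂ (inj₂ twin-uv)    = Sum.map₁ const (twin-pair twin-uv matched)

theorem6p3 : ∀ (n : ℕ) (G : Graph n) → n ≥ 3 → Connected G → size G ≥ ((n ∸ 2) C 2) + 2 →
    (∃[ k ] (IsProperRainbowConnectionNumber G k × IsChromaticIndex G k))
    ⊎ (G ≅ P₄ ⊎ G ≅ Z₂ ⊎ G ≅ G₆₋₃)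
theorem6p3 n G n≥3@(s≤s (s≤s (s≤s _))) connected size≥ =
  case chromaticIndex G (proj₂ (neighbour G connected {0F} {1F} λ ())) of λ where
      (k , χ′@((c , proper) , _)) → case rainbow-or-exceptional n≥3 connected size≥ c proper of λ where
        (inj₁ rainbow)           → inj₁ (k , prc≡χ′ χ′ (c , proper , rainbow) , χ′)
        (inj₂ (inj₁ iso))        → inj₂ iso
        (inj₂ (inj₂ upgradable)) → inj₁ (k , prc≡χ′ χ′ (upgradable k (c , proper)) , χ′)
  where
  -- The lower bound is inherited: forgetting rainbow connectedness leaves a proper colouring.
  prc≡χ′ : ∀ {k} → IsChromaticIndex G k → HasProperRainbow G k → IsProperRainbowConnectionNumber G k
  prc≡χ′ (_ , k-min) rainbow = rainbow , λ j (c , proper , _) → k-min j (c , proper)
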